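{- Let $M$ be a one-tape NTM with $q$ states and let $C,D\in\mathbb N$. Put $\ell=D+8q^C$, $r=D+12q^C$ and $\mathcal S=\bigcup_{n=1}^{\ell}\mathcal S_n(M)$. Then $M$ runs in time $Cn+D$ if and only if both of the following hold: (a) for every input $w$ with $|w|\le\ell$ and every computation $\zeta$ of $M$ on $w$, $|\zeta|\le C|w|+D$; (b) for every $\mathcal C\in\mathcal S$ and every part $w\in\Sigma^+$ with $|w|\le r$ and $t_M(w,\mathcal C)\ge 0$, we have $t_M(w,\mathcal C)\le C|w|$.
   Context: A one-tape NTM is $M=(Q,\Sigma,\Gamma,\sqcup,\delta,q_0,q_{acc},q_{rej})$ with $\delta:(Q\setminus\{q_{acc},q_{rej}\})\times\Gamma\to\mathcal P(Q\times\Gamma\times\{ -1,1\})\setminus\{\emptyset\}$ (head moves every step), start, accept, reject states pairwise distinct. $|\zeta|$ is the number of steps of computation $\zeta$; $M$ runs in time $T(n)$ if every computation on every input of length $n$ has at most $T(n)$ steps. Tape cells are numbered by integers, $M$ starts on cell $0$, and input $w$ has its $i$-th symbol in cell $i-1$, other cells blank; boundary $i$ is the boundary between cells $i-1$ and $i$. If in the first $t$ steps of computation $\zeta$ on $w$ the head crosses boundary $i$ at steps $t_1<t_2<\dots$ and $M$ is in state $q_j$ after step $t_j$, the crossing sequence is $\mathcal C_i^t(M,\zeta,w)=(q_1,q_2,\dots)$. Define $\mathcal S_n(M)=\{\mathcal C_i^t(M,\zeta,w): |w|=n,\ 1\le i\le n,\ \zeta$ a computation on $w$, $t\le|\zeta|\}$.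 Computation on a part: let $w$ with $|w|=n\ge1$ and $\mathcal C=(q_1,\dots,q_l)$ finite. Configurations are tuples $(\mathcal C_1,\tilde w,i,\tilde q,\mathcal C_2)$ with $\tilde w\in\Gamma^n$, $0\le i\le n-1$, $\tilde q\in Q$, $\mathcal C_1,\mathcal C_2$ sequences of states. The start configuration is $((q_2,\dots,q_l),w,0,q_1,(q_1,\dots,q_l))$. $(\mathcal C_{1A},w_A,i,q_A,\mathcal C_{2A})$ can be followed by $(\mathcal C_{1B},w_B,j,q_B,\mathcal C_{2B})$ if either (1) $(w_A,i,q_A)\to(w_B,j,q_B)$ is an ordinary move of $M$ staying within cells $0..n-1$ and $\mathcal C_{1A}=\mathcal C_{1B}$, $\mathcal C_{2A}=\mathcal C_{2B}$; or (2) $i=j=0$, $\mathcal C_{1A}=(\tilde q,q_B,\mathcal C_{1B})$, $w_A=a\hat w$, $w_B=b\hat w$, $(\tilde q,b,-1)\in\delta(q_A,a)$, $\mathcal C_{2A}=\mathcal C_{2B}$; or (3) $i=j=n-1$, $\mathcal C_{2A}=(\tilde q,q_B,\mathcal C_{2B})$, $w_A=\hat wa$, $w_B=\hat wb$, $(\tilde q,b,1)\in\delta(q_A,a)$, $\mathcal C_{1A}=\mathcal C_{1B}$. A special ending configuration follows $((q_l),a\hat w,0,\tilde q,())$ if $(q_l,b,-1)\in\delta(\tilde q,a)$ for some $b$, or $((),\hat wa,n-1,\tilde q,(q_l))$ if $(q_l,b,1)\in\delta(\tilde q,a)$ for some $b$. A valid computation $\zeta$ of $M$ on part $w$ with ending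 crossing sequence $\mathcal C$ is a sequence of successive configurations from the start configuration to an ending configuration; its length is $|\zeta|=\sum_{i=1}^{n-1}|\mathcal C_i(M,\zeta,w,\mathcal C)|+|\mathcal C|$, where $\mathcal C_i(M,\zeta,w,\mathcal C)$ is the crossing sequence produced on internal boundary $i$. $t_M(w,\mathcal C)\in\mathbb N\cup\{ -1\}$ is the maximum length of such valid computations, and $-1$ if none exists or $|\mathcal C|=\infty$. -}

module Defs where

open import Data.Nat as ℕ using (ℕ; zero; suc; _+_; _*_; _∸_; _^_; _≤_; _<_; _<?_)
open import Data.Integer as ℤ using (ℤ; +_; -[1+_])
open import Data.Fin using (Fin; zero; suc; toℕ; fromℕ; fromℕ<)
open import Data.Vec as Vec using (Vec; lookup; _[_]≔_)
open import Data.List using (List; []; _∷_; _++_; length; map; upTo; take)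
open import Data.Nat.ListAction using (sum)
open import Data.Bool using (Bool; true; false; if_then_else_)
open import Data.Product using (Σ; _×_; _,_; Σ-syntax)
open import Data.Sum using (_⊎_)
open import Data.Empty using (⊥)
open import Data.Unit using (⊤)
open import Relation.Binary.PropositionalEquality using (_≡_; _≢_)
open import Relation.Nullary using (does; yes; no)

data Dir : Set where
  left right : Dir

-- A one-tape NTM.  Q = Fin nQ (so nQ is the number of states),
-- Γ = Fin nΓ, Σ = Fin nΣ embedded into Γ by the injective map inp,
-- blank ∈ Γ \ Σ.  δ is given by its characteristic function; it is only
-- consulted on non-halting states (see Trans), and is required to be
-- nonempty there.
record NTM : Set where
  field
    nQ nΓ nΣ : ℕ
    inp : Fin nΣ → Fin nΓ
    inp-injective : ∀ a b → inp a ≡ inp b → a ≡ b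
    blank : Fin nΓ
    blank∉Σ : ∀ a → inp a ≢ blank
    δ : Fin nQ → Fin nΓ → Fin nQ → Fin nΓ → Dir → Bool
    q₀ qacc qrej : Fin nQ
    q₀≢qacc : q₀ ≢ qacc
    q₀≢qrej : q₀ ≢ qrej
    qacc≢qrej : qacc ≢ qrej
    δ-nonempty : ∀ p a → p ≢ qacc → p ≢ qrej →
      Σ[ q ∈ Fin nQ ] Σ[ b ∈ Fin nΓ ] Σ[ d ∈ Dir ] δ p a q b d ≡ true

module _ (M : NTM) where
  open NTM M

  State : Set
  State = Fin nQ

  Tape : Set
  Tape = Fin nΓ

  Sym : Set
  Sym = Fin nΣ

  Trans : State → Tape → State → Tape → Dir → Set
  Trans p a q b d = p ≢ qacc × p ≢ qrej × δ p a q b d ≡ true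

  Halting : State → Set
  Halting s = s ≡ qacc ⊎ s ≡ qrej

  Move : Set
  Move = State × Tape × Dir

  record Config : Set where
    constructor cfg
    field
      tape : ℤ → Tape
      pos : ℤ
      st : State

  dirℤ : Dir → ℤ
  dirℤ left = -[1+ 0 ]
  dirℤ right = + 1

  write : (ℤ → Tape) → ℤ → Tape → ℤ → Tape
  write t p b j = if does (j ℤ.≟ p) then b else t j

  apply : Config → Move → Config
  apply (cfg t p s) (q , b , d) = cfg (write t p b) (p ℤ.+ dirℤ d) q

  Allowed : Config → Move → Set
  Allowed (cfg t p s) (q , b , d) = Trans s (t p) q b d

  ValidFrom : Config → List Move → Set
  ValidFrom c [] = ⊤
  ValidFrom c (m ∷ ms) = Allowed c m × ValidFrom (apply c m) ms

  runEnd : Config → List Move → Config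
  runEnd c [] = c
  runEnd c (m ∷ ms) = runEnd (apply c m) ms

  initTape : ∀ {n} → Vec Sym n → ℤ → Tape
  initTape {n} w (+ k) with k <? n
  ... | yes k<n = inp (lookup w (fromℕ< k<n))
  ... | no _ = blank
  initTape w -[1+ _ ] = blank

  initConfig : ∀ {n} → Vec Sym n → Config
  initConfig w = cfg (initTape w) (+ 0) q₀

  iter : Config → (ℕ → Move) → ℕ → Config
  iter c f zero = c
  iter c f (suc k) = apply (iter c f k) (f k)

  -- a computation is maximal: either finite and ending in a halting state
  -- (halting states have no moves, non-halting ones always have one),
  -- or infinite
  data Computation {n : ℕ} (w : Vec Sym n) : Set where
    halting : (ms : List Move) → ValidFrom (initConfig w) ms →
              Halting (Config.st (runEnd (initConfig w) ms)) → Computation w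
    infinite : (f : ℕ → Move) →
               (∀ k → Allowed (iter (initConfig w) f k) (f k)) → Computation w

  LengthAtMost : ∀ {n} {w : Vec Sym n} → Computation w → ℕ → Set
  LengthAtMost (halting ms _ _) T = length ms ≤ T
  LengthAtMost (infinite _ _) T = ⊥

  StepsAtLeast : ∀ {n} {w : Vec Sym n} → ℕ → Computation w → Set
  StepsAtLeast t (halting ms _ _) = t ≤ length ms
  StepsAtLeast t (infinite _ _) = ⊤

  firstSteps : ∀ {n} {w : Vec Sym n} → Computation w → ℕ → List Move
  firstSteps (halting ms _ _) t = take t ms
  firstSteps (infinite f _) t = map f (upTo t)

  -- does a move in direction d from cell p cross boundary b
  -- (boundary b lies between cells b-1 and b)?
  crosses : ℤ → ℤ → Dir → Bool
  crosses b p right = does ((p ℤ.+ + 1) ℤ.≟ b)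
  crosses b p left = does (p ℤ.≟ b)

  crossSeq : ℤ → ℤ → List Move → List State
  crossSeq b p [] = []
  crossSeq b p ((q , _ , d) ∷ ms) =
    if crosses b p d then q ∷ rest else rest
    where rest = crossSeq b (p ℤ.+ dirℤ d) ms

  CrossingSeq : ∀ {n} {w : Vec Sym n} → ℕ → ℕ → Computation w → List State
  CrossingSeq i t ζ = crossSeq (+ i) (+ 0) (firstSteps ζ t)

  InS : ℕ → List State → Set
  InS n cs = Σ[ w ∈ Vec Sym n ] Σ[ i ∈ ℕ ] (1 ≤ i × i ≤ n ×
             (Σ[ ζ ∈ Computation w ] Σ[ t ∈ ℕ ]
               (StepsAtLeast t ζ × CrossingSeq i t ζ ≡ cs)))

  InSUpTo : ℕ → List State → Set
  InSUpTo ℓ cs = Σ[ n ∈ ℕ ] (1 ≤ n × n ≤ ℓ × InS n cs)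

  RunsInTime : (ℕ → ℕ) → Set
  RunsInTime T = ∀ n (w : Vec Sym n) (ζ : Computation w) → LengthAtMost ζ (T n)

  record PConf (m : ℕ) : Set where
    constructor pcfg
    field
      C₁ : List State
      ptape : Vec Tape (suc m)
      ppos : Fin (suc m)
      pst : State
      C₂ : List State

  Adjacent : ∀ {k} → Dir → Fin k → Fin k → Set
  Adjacent right i j = toℕ j ≡ suc (toℕ i)
  Adjacent left i j = suc (toℕ j) ≡ toℕ i

  data PStep {m : ℕ} : PConf m → PConf m → Set where
    internal : ∀ {c₁ c₂ tp i j s q b} d → Trans s (lookup tp i) q b d →
      Adjacent d i j →
      PStep (pcfg c₁ tp i s c₂) (pcfg c₁ (tp [ i ]≔ b) j q c₂)
    -- (2) leaving to the left and re-entering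
    leftB : ∀ {c₁ c₂ tp s q̃ qB b} → Trans s (lookup tp zero) q̃ b left →
      PStep (pcfg (q̃ ∷ qB ∷ c₁) tp zero s c₂) (pcfg c₁ (tp [ zero ]≔ b) zero qB c₂)
    -- (3) leaving to the right and re-entering
    rightB : ∀ {c₁ c₂ tp s q̃ qB b} → Trans s (lookup tp (fromℕ m)) q̃ b right →
      PStep (pcfg c₁ tp (fromℕ m) s (q̃ ∷ qB ∷ c₂))
            (pcfg c₁ (tp [ fromℕ m ]≔ b) (fromℕ m) qB c₂)

  -- configurations that can be followed by the special ending configuration
  data PEnd {m : ℕ} (ql : State) : PConf m → Set where
    leftE : ∀ {tp s b} → Trans s (lookup tp zero) ql b left →
      PEnd ql (pcfg (ql ∷ []) tp zero s [])
    rightE : ∀ {tp s b} → Trans s (lookup tp (fromℕ m)) ql b right →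
      PEnd ql (pcfg [] tp (fromℕ m) s (ql ∷ []))

  data PRun {m : ℕ} (ql : State) : PConf m → Set where
    finish : ∀ {c} → PEnd ql c → PRun ql c
    _▸_ : ∀ {c c'} → PStep c c' → PRun ql c' → PRun ql c

  stepCross : ∀ {m} {c c' : PConf m} → ℕ → PStep c c' → List State
  stepCross j (internal {i = i} {q = q} right _ _) =
    if does (suc (toℕ i) ℕ.≟ j) then q ∷ [] else []
  stepCross j (internal {i = i} {q = q} left _ _) =
    if does (toℕ i ℕ.≟ j) then q ∷ [] else []
  stepCross j (leftB _) = []
  stepCross j (rightB _) = []

  pcross : ∀ {m ql} {c : PConf m} → ℕ → PRun ql c → List State
  pcross j (finish _) = []
  pcross j (s ▸ r) = stepCross j s ++ pcross j r

  lastOf : State → List State → State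
  lastOf q [] = q
  lastOf _ (q ∷ qs) = lastOf q qs

  PartComputation : ∀ {m} → Vec Sym (suc m) → List State → Set
  PartComputation w [] = ⊥
  PartComputation w (q₁ ∷ rest) =
    PRun (lastOf q₁ rest) (pcfg rest (Vec.map inp w) zero q₁ (q₁ ∷ rest))

  partLength : ∀ {m} (w : Vec Sym (suc m)) (cs : List State) →
    PartComputation w cs → ℕ
  partLength w [] ()
  partLength {m} w (q₁ ∷ rest) ζ =
    sum (map (λ j → length (pcross j ζ)) (map suc (upTo m))) + length (q₁ ∷ rest)

module Submission where

-- A run on an input is a path in a graph whose vertices are crossing sequences
-- and whose edges are tape cells: single-cell runs compatible with the crossing
-- sequences on both sides can be glued together, and every run is cut into such
-- pieces.  The number of steps is the total length of the crossing sequences.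
--
-- If a part with crossing sequence cs on both sides takes more than C steps per
-- cell, inserting it repeatedly at a boundary where cs occurs breaks the bound
-- C n + D.  Conversely, on a shortest input of length n with a run of C n + D + 1
-- steps, every stretch between two equal crossing sequences takes more than C
-- steps per cell, since cutting it out leaves a run within the bound.  Jumping
-- over such stretches leaves pairwise distinct crossing sequences; giving each
-- v the deficit C + 1 - |v| (if positive), N distinct ones have total length at
-- least (C + 1) N - P, where P = Σ_{k ≤ C} (C + 1 - k) q^k is of order q^C.
-- Counting yields an innermost repetition of length at most r whose crossing
-- sequence already occurs on an input of length at most ℓ.

open import Defs
open import Data.Nat using (ℕ; zero; suc; _+_; _*_; _∸_; _^_; _≤_; _<_; z≤n; s≤s)
open import Data.Vec.Properties using (length-toList)
import Data.Nat as ℕ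
open import Data.Nat.Induction using (<-rec)
open import Data.Nat.Properties
open import Data.Integer as ℤ using (ℤ; -[1+_]) renaming (+_ to pos)
import Data.Integer.Properties as ℤ
open import Algebra.Properties.AbelianGroup ℤ.+-0-abelianGroup using (identityʳ-unique; ∙-cancelˡ)
open import Data.Fin using (Fin; zero; suc; toℕ; fromℕ)
import Data.Fin.Properties as Fin
open import Data.Vec as Vec using (Vec; []; _∷_; lookup; _[_]≔_; fromList)
open import Data.List using (List; []; _∷_; _++_; length; map; upTo; applyUpTo; take; allFin; cartesianProductWith)
open import Data.List.Properties using (length-applyUpTo; map-upTo; map-applyUpTo; length-++; length-++-≤ˡ; length-++-≤ʳ; ++-assoc; length-take; map-++; length-tabulate; ≡-dec)
open import Data.List.Membership.Propositional using (_∈_; _∉_)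
open import Data.List.Membership.Propositional.Properties using (∈-∃++; ∈-++⁻; ∈-++⁺ˡ; ∈-++⁺ʳ; ∈-cartesianProductWith⁺; ∈-allFin)
import Data.List.Membership.DecPropositional as DecMembership
open import Data.List.Relation.Unary.Any using (here; there)
open import Data.List.Relation.Unary.All as All using (All; []; _∷_)
open import Data.List.Relation.Unary.All.Properties using (¬Any⇒All¬; ++⁻ˡ)
open import Data.List.Relation.Unary.AllPairs using ([]; _∷_)
open import Data.List.Relation.Unary.Unique.Propositional using (Unique)
open import Data.Nat.Tactic.RingSolver using (solve-∀)
open import Data.Product using (_×_; _,_; proj₁; proj₂; Σ-syntax; ∃-syntax)
open import Data.Sum using (_⊎_; inj₁; inj₂)
open import Data.Empty using (⊥; ⊥-elim)
open import Data.Unit using (⊤; tt)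
open import Data.Bool using (Bool; true; false; not; _xor_; if_then_else_)
open import Data.Bool.Properties using (not-involutive)
open import Function using (_∘_; const)
open import Function.Bundles using (_⇔_; mk⇔)
open import Relation.Binary.Definitions using (DecidableEquality)
open import Relation.Binary.PropositionalEquality hiding (J)
open import Relation.Nullary using (¬_; does; yes; no)
open import Relation.Nullary.Decidable using (dec-true; dec-false)
open import Data.Nat.ListAction using (sum)
open import Data.Nat.ListAction.Properties using (sum-++)

-- Lists: sequences with a finite prefix, sums, and innermost repetitions.

infixr 4 _▹_

_▹_ : ∀ {A : Set} → List A → (ℕ → A) → ℕ → A
([] ▹ f) k = f k
(x ∷ xs ▹ f) zero = x
(x ∷ xs ▹ f) (suc k) = (xs ▹ f) k

take-length-++ : ∀ {A : Set} (xs ys : List A) → take (length xs) (xs ++ ys) ≡ xs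
take-length-++ [] ys = refl
take-length-++ (x ∷ xs) ys = cong (x ∷_) (take-length-++ xs ys)

sum-map-++ : ∀ {A : Set} (f : A → ℕ) xs ys →
  sum (map f (xs ++ ys)) ≡ sum (map f xs) + sum (map f ys)
sum-map-++ f xs ys = trans (cong sum (map-++ f xs ys)) (sum-++ (map f xs) (map f ys))

module _ {A : Set} where

  ∈-remove : ∀ {x y : A} xs {ys} → x ≢ y → y ∈ xs ++ x ∷ ys → y ∈ xs ++ ys
  ∈-remove xs x≢y y∈ with ∈-++⁻ xs y∈
  ... | inj₁ y∈xs = ∈-++⁺ˡ y∈xs
  ... | inj₂ (here e) = ⊥-elim (x≢y (sym e))
  ... | inj₂ (there y∈ys) = ∈-++⁺ʳ xs y∈ys

  module _ (f : A → ℕ) where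

    sum-map-remove : ∀ xs y ys → sum (map f (xs ++ y ∷ ys)) ≡ f y + sum (map f (xs ++ ys))
    sum-map-remove [] y ys = refl
    sum-map-remove (x ∷ xs) y ys = trans (cong (f x +_) (sum-map-remove xs y ys))
      (swap (f x) (f y) (sum (map f (xs ++ ys))))
      where
      swap : ∀ a b c → a + (b + c) ≡ b + (a + c)
      swap = solve-∀

    -- Each x with a nonzero value is struck out of `ys` once; uniqueness keeps the later ones in
    -- what is left. Values 0 need no partner, so `ys` only has to cover the support of f.
    sum-map-mono-unique : ∀ {xs} ys → Unique xs → (∀ {x} → x ∈ xs → f x ≢ 0 → x ∈ ys) →
      sum (map f xs) ≤ sum (map f ys)
    sum-map-mono-unique ys [] sub = z≤n
    sum-map-mono-unique {x ∷ xs} ys (x∉ ∷ u) sub with f x ℕ.≟ 0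
    ... | yes e = subst (λ k → k + sum (map f xs) ≤ sum (map f ys)) (sym e)
      (sum-map-mono-unique ys u (sub ∘ there))
    ... | no n with ∈-∃++ (sub (here refl) n)
    ... | as , bs , refl = ≤-trans
      (+-monoʳ-≤ (f x) (sum-map-mono-unique (as ++ bs) u λ y∈ ny →
        ∈-remove as (All.lookup x∉ y∈) (sub (there y∈) ny)))
      (≤-reflexive (sym (sum-map-remove as x bs)))

  module _ (_≟_ : DecidableEquality A) where

    open DecMembership _≟_ using (_∈?_)

    lastOccurrence : ∀ {x} xs → x ∈ xs → ∃[ as ] ∃[ bs ] xs ≡ as ++ x ∷ bs × x ∉ bs
    lastOccurrence {x} (y ∷ xs) x∈ with x ∈? xs
    lastOccurrence (y ∷ xs) x∈ | yes x∈xs with lastOccurrence xs x∈xs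
    ... | as , bs , refl , x∉bs = y ∷ as , bs , refl , x∉bs
    lastOccurrence (y ∷ xs) (here refl) | no x∉xs = [] , xs , refl , x∉xs
    lastOccurrence (y ∷ xs) (there x∈xs) | no x∉xs = ⊥-elim (x∉xs x∈xs)

    record InnermostRepetition (xs : List A) : Set where
      constructor repetition
      field
        {before} : List A
        {letter} : A
        {between after} : List A
        decomposition : xs ≡ before ++ (letter ∷ between) ++ letter ∷ after
        unique : Unique (letter ∷ between)

    unique-prefix : ∀ as {bs : List A} → Unique (as ++ bs) → Unique as
    unique-prefix [] u = []
    unique-prefix (x ∷ as) (x∉ ∷ u) = ++⁻ˡ as x∉ ∷ unique-prefix as u

    unique-∉ : ∀ {x} as {bs : List A} → Unique (as ++ x ∷ bs) → x ∉ as
    unique-∉ (y ∷ as) (y∉ ∷ u) (here refl) = All.lookup y∉ (∈-++⁺ʳ as (here refl)) refl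
    unique-∉ (y ∷ as) (y∉ ∷ u) (there x∈) = unique-∉ as u x∈

    -- Scanning from the right, the first letter that recurs in the still duplicate-free suffix
    -- closes a stretch without inner repetitions.
    unique-or-repetition : ∀ xs → Unique xs ⊎ InnermostRepetition xs
    unique-or-repetition [] = inj₁ []
    unique-or-repetition (x ∷ xs) with unique-or-repetition xs
    ... | inj₂ (repetition {as} e u) = inj₂ (repetition {before = x ∷ as} (cong (x ∷_) e) u)
    ... | inj₁ u with x ∈? xs
    ... | no x∉ = inj₁ (¬Any⇒All¬ xs x∉ ∷ u)
    ... | yes x∈ with ∈-∃++ x∈
    ... | bs , zs , refl = inj₂ (repetition {before = []} refl
      (¬Any⇒All¬ bs (unique-∉ bs u) ∷ unique-prefix bs u))

-- Counting distinct words by their deficit in length.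

module _ (q : ℕ) where

  wordsBelow : ℕ → List (List (Fin q))
  wordsBelow zero = []
  wordsBelow (suc K) = [] ∷ cartesianProductWith _∷_ (allFin q) (wordsBelow K)

  deficit : ℕ → List (Fin q) → ℕ
  deficit K v = K ∸ length v

  ∈-wordsBelow : ∀ K v → deficit K v ≢ 0 → v ∈ wordsBelow K
  ∈-wordsBelow zero v n = ⊥-elim (n (0∸n≡0 (length v)))
  ∈-wordsBelow (suc K) [] n = here refl
  ∈-wordsBelow (suc K) (x ∷ v) n =
    there (∈-cartesianProductWith⁺ _∷_ (∈-allFin x) (∈-wordsBelow K v n))

  -- Horner form of the sum of (K - k) q^k over k < K, that is, the deficits of all words over q
  -- letters.
  totalDeficit : ℕ → ℕ
  totalDeficit zero = 0
  totalDeficit (suc K) = suc K + q * totalDeficit K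

  deficit-tails : ∀ K x vs → sum (map (deficit (suc K)) (map (x ∷_) vs)) ≡ sum (map (deficit K) vs)
  deficit-tails K x [] = refl
  deficit-tails K x (v ∷ vs) = cong (deficit K v +_) (deficit-tails K x vs)

  deficit-product : ∀ K xs vs → sum (map (deficit (suc K)) (cartesianProductWith _∷_ xs vs))
    ≡ length xs * sum (map (deficit K) vs)
  deficit-product K [] vs = refl
  deficit-product K (x ∷ xs) vs = trans (sum-map-++ (deficit (suc K)) (map (x ∷_) vs) _)
    (cong₂ _+_ (deficit-tails K x vs) (deficit-product K xs vs))

  deficit-wordsBelow : ∀ K → sum (map (deficit K) (wordsBelow K)) ≡ totalDeficit K
  deficit-wordsBelow zero = refl
  deficit-wordsBelow (suc K) = cong (suc K +_) (trans (deficit-product K (allFin q) (wordsBelow K))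
    (cong₂ _*_ (length-tabulate {n = q} (λ i → i)) (deficit-wordsBelow K)))

  *-length≤ : ∀ K vs → K * length vs ≤ sum (map length vs) + sum (map (deficit K) vs)
  *-length≤ K [] = ≤-reflexive (*-zeroʳ K)
  *-length≤ K (v ∷ vs) = begin
    K * suc (length vs)           ≡⟨ *-suc K (length vs) ⟩
    K + K * length vs             ≤⟨ +-mono-≤ (m≤n+m∸n K (length v)) (*-length≤ K vs) ⟩
    length v + deficit K v + (sum (map length vs) + sum (map (deficit K) vs))
      ≡⟨ regroup (length v) (deficit K v) _ _ ⟩
    length v + sum (map length vs) + (deficit K v + sum (map (deficit K) vs)) ∎
    where
    open ≤-Reasoning
    regroup : ∀ a b c d → a + b + (c + d) ≡ a + c + (b + d)
    regroup = solve-∀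

  -- Only words shorter than K have a deficit, and a duplicate-free list contains each of them at
  -- most once.
  unique⇒*-length≤ : ∀ K {vs} → Unique vs → K * length vs ≤ sum (map length vs) + totalDeficit K
  unique⇒*-length≤ K {vs} u = ≤-trans (*-length≤ K vs) (+-monoʳ-≤ (sum (map length vs))
    (≤-trans (sum-map-mono-unique (deficit K) (wordsBelow K) u λ {v} _ → ∈-wordsBelow K v)
      (≤-reflexive (deficit-wordsBelow K))))

  -- The summand C + 2 strengthens the induction and later absorbs the additive constants in
  -- `count`.
  totalDeficit-bound : 3 ≤ q → ∀ C → totalDeficit (suc C) + (C + 2) ≤ 3 * q ^ C
  totalDeficit-bound 3≤q zero = ≤-reflexive (cong (λ k → suc (k + 2)) (*-zeroʳ q))
  totalDeficit-bound 3≤q (suc C) = begin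
    -- Padding by C + 1 rounds the constants up to 3 (C + 2), which is at most q (C + 2).
    suc (suc C) + q * P + (suc C + 2)   ≤⟨ m≤n+m _ (suc C) ⟩
    suc C + (suc (suc C) + q * P + (suc C + 2)) ≡⟨ regroup C (q * P) ⟩
    q * P + 3 * (C + 2)                 ≤⟨ +-monoʳ-≤ (q * P) (*-monoˡ-≤ (C + 2) 3≤q) ⟩
    q * P + q * (C + 2)                 ≡⟨ *-distribˡ-+ q P (C + 2) ⟨
    q * (P + (C + 2))                   ≤⟨ *-monoʳ-≤ q (totalDeficit-bound 3≤q C) ⟩
    q * (3 * q ^ C)                     ≡⟨ commute q (q ^ C) ⟩
    3 * (q * q ^ C)                     ∎
    where
    open ≤-Reasoning
    P = totalDeficit (suc C)
    regroup : ∀ C R → suc C + (suc (suc C) + R + (suc C + 2)) ≡ R + 3 * (C + 2)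
    regroup = solve-∀
    commute : ∀ a b → a * (3 * b) ≡ 3 * (a * b)
    commute = solve-∀

-- Maximal computations versus finite runs.

module Computations (M : NTM) where
  open NTM M

  halting? : (s : State M) → Halting M s ⊎ (s ≢ qacc × s ≢ qrej)
  halting? s with s Fin.≟ qacc | s Fin.≟ qrej
  ... | yes e | _ = inj₁ (inj₁ e)
  ... | no _ | yes e = inj₁ (inj₂ e)
  ... | no n | no n′ = inj₂ (n , n′)

  -- The value on a halting configuration is junk.
  nextMove : Config M → Move M
  nextMove (cfg t p s) with halting? s
  ... | inj₁ _ = q₀ , blank , left
  ... | inj₂ (n , n′) with δ-nonempty s (t p) n n′
  ... | q , b , d , _ = q , b , d

  nextMove-allowed : ∀ c → ¬ Halting M (Config.st c) → Allowed M c (nextMove c)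
  nextMove-allowed (cfg t p s) nh with halting? s
  ... | inj₁ h = ⊥-elim (nh h)
  ... | inj₂ (n , n′) with δ-nonempty s (t p) n n′
  ... | q , b , d , e = n , n′ , e

  AllAllowed : Config M → (ℕ → Move M) → Set
  AllAllowed c f = ∀ k → Allowed M (iter M c f k) (f k)

  iter-shift : ∀ c f k → iter M c f (suc k) ≡ iter M (apply M c (f 0)) (f ∘ suc) k
  iter-shift c f zero = refl
  iter-shift c f (suc k) = cong (λ c′ → apply M c′ (f (suc k))) (iter-shift c f k)

  allAllowed-cons : ∀ {c} f → Allowed M c (f 0) →
    AllAllowed (apply M c (f 0)) (f ∘ suc) → AllAllowed c f
  allAllowed-cons f a as zero = a
  allAllowed-cons {c} f a as (suc k) =
    subst (λ c′ → Allowed M c′ (f (suc k))) (sym (iter-shift c f k)) (as k)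

  prefix-valid : ∀ c f → AllAllowed c f → ∀ k → ValidFrom M c (applyUpTo f k)
  prefix-valid c f as zero = tt
  prefix-valid c f as (suc k) = as 0 , prefix-valid _ (f ∘ suc)
    (λ j → subst (λ c′ → Allowed M c′ (f (suc j))) (iter-shift c f j) (as (suc j))) k

  greedy : Config M → ℕ → Move M
  greedy c zero = nextMove c
  greedy c (suc k) = greedy (apply M c (nextMove c)) k

  NeverHalts : Config M → Set
  NeverHalts c = ∀ ms → ValidFrom M c ms → ¬ Halting M (Config.st (runEnd M c ms))

  greedy-allowed : ∀ c → NeverHalts c → AllAllowed c (greedy c)
  greedy-allowed c nh zero = nextMove-allowed c (nh [] tt)
  greedy-allowed c nh (suc k) =
    subst (λ c′ → Allowed M c′ (greedy c (suc k))) (sym (iter-shift c (greedy c) k))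
      (greedy-allowed (apply M c (nextMove c))
        (λ ms v → nh (nextMove c ∷ ms) (nextMove-allowed c (nh [] tt) , v)) k)

  -- Stated for an arbitrary configuration, so that it passes to the configuration after one move
  -- with T lowered by one.
  record BoundedBy (c : Config M) (T : ℕ) : Set where
    field
      finite : ∀ ms → ValidFrom M c ms → Halting M (Config.st (runEnd M c ms)) → length ms ≤ T
      terminating : ∀ f → ¬ AllAllowed c f
  open BoundedBy

  -- A run longer than T would have to be neither extendable to a halting
  -- run nor to an infinite one, but continuing it greedily gives one of the two.
  boundedBy⇒length≤ : ∀ {c T} → BoundedBy c T → ∀ ms → ValidFrom M c ms → length ms ≤ T
  boundedBy⇒length≤ bd [] v = z≤n
  boundedBy⇒length≤ {c} {zero} bd (m ∷ ms) (a , v) =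
    ⊥-elim (terminating bd ((m ∷ []) ▹ greedy _)
      (allAllowed-cons _ a (greedy-allowed _ λ ms′ v′ h →
        1+n≰n (≤-trans (finite bd (m ∷ ms′) (a , v′) h) z≤n))))
  boundedBy⇒length≤ {c} {suc T} bd (m ∷ ms) (a , v) = s≤s (boundedBy⇒length≤ bd′ ms v)
    where
    bd′ : BoundedBy (apply M c m) T
    finite bd′ ms′ v′ h = ≤-pred (finite bd (m ∷ ms′) (a , v′) h)
    terminating bd′ f as = terminating bd ((m ∷ []) ▹ f) (allAllowed-cons _ a as)

  module _ {n : ℕ} (w : Vec (Sym M) n) (T : ℕ) where

    AllComputations≤ AllRuns≤ : Set
    AllComputations≤ = (ζ : Computation M w) → LengthAtMost M ζ T
    AllRuns≤ = ∀ ms → ValidFrom M (initConfig M w) ms → length ms ≤ T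

    computations≤⇒runs≤ : AllComputations≤ → AllRuns≤
    computations≤⇒runs≤ h = boundedBy⇒length≤ record
      { finite = λ ms v e → h (halting ms v e)
      ; terminating = λ f as → h (infinite f as) }

    runs≤⇒computations≤ : AllRuns≤ → AllComputations≤
    runs≤⇒computations≤ h (halting ms v _) = h ms v
    runs≤⇒computations≤ h (infinite f as) = 1+n≰n
      (subst (_≤ T) (length-applyUpTo f (suc T))
        (h (applyUpTo f (suc T)) (prefix-valid _ f as (suc T))))

  -- `InS` speaks of maximal computations, so a finite run has to be completed to one. The bound T
  -- on all runs from c makes the recursion terminate.
  haltingExtension : ∀ T c → (∀ ms → ValidFrom M c ms → length ms ≤ T) →
    ∃[ ms ] ValidFrom M c ms × Halting M (Config.st (runEnd M c ms))
  haltingExtension T c h with halting? (Config.st c)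
  ... | inj₁ e = [] , tt , e
  haltingExtension T c h | inj₂ (n , n′)
    with nextMove c | nextMove-allowed c (λ { (inj₁ e) → n e ; (inj₂ e) → n′ e })
  haltingExtension zero c h | inj₂ _ | m | a = ⊥-elim (1+n≰n (h (m ∷ []) (a , tt)))
  haltingExtension (suc T) c h | inj₂ _ | m | a
    with haltingExtension T (apply M c m) (λ ms v → ≤-pred (h (m ∷ ms) (a , v)))
  ... | ms , v , e = m ∷ ms , (a , v) , e

  ++-valid : ∀ {c} ms {ms′} → ValidFrom M c ms → ValidFrom M (runEnd M c ms) ms′ →
    ValidFrom M c (ms ++ ms′)
  ++-valid [] v v′ = v′
  ++-valid (m ∷ ms) (a , v) v′ = a , ++-valid ms v v′

  runEnd-++ : ∀ c ms ms′ → runEnd M c (ms ++ ms′) ≡ runEnd M (runEnd M c ms) ms′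
  runEnd-++ c [] ms′ = refl
  runEnd-++ c (m ∷ ms) ms′ = runEnd-++ (apply M c m) ms ms′

  take-valid : ∀ {c} t ms → ValidFrom M c ms → ValidFrom M c (take t ms)
  take-valid zero ms v = tt
  take-valid (suc t) [] v = tt
  take-valid (suc t) (m ∷ ms) (a , v) = a , take-valid t ms v

  firstSteps-valid : ∀ {n} {w : Vec (Sym M) n} (ζ : Computation M w) t →
    ValidFrom M (initConfig M w) (firstSteps M ζ t)
  firstSteps-valid (halting ms v _) t = take-valid t ms v
  firstSteps-valid (infinite f as) t =
    subst (ValidFrom M _) (sym (map-upTo f t)) (prefix-valid _ f as t)

  run∈S : ∀ {n T} (w : Vec (Sym M) n) → AllRuns≤ w T → ∀ ms → ValidFrom M (initConfig M w) ms →
    ∀ i → 1 ≤ i → i ≤ n → InS M n (crossSeq M (pos i) (pos 0) ms)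
  run∈S {T = T} w h ms v i 1≤i i≤n
    with haltingExtension T (runEnd M (initConfig M w) ms)
           (λ ms′ v′ → ≤-trans (length-++-≤ʳ ms′ {ms}) (h (ms ++ ms′) (++-valid ms v v′)))
  ... | ms′ , v′ , e = w , i , 1≤i , i≤n
    , halting (ms ++ ms′) (++-valid ms v v′)
        (subst (Halting M ∘ Config.st) (sym (runEnd-++ (initConfig M w) ms ms′)) e)
    , length ms , length-++-≤ˡ ms
    , cong (crossSeq M (pos i) (pos 0)) (take-length-++ ms ms′)

-- Cutting runs into single cells and gluing cells to runs.

module Cells (M : NTM) where
  open NTM M

  Word : Set
  Word = List (State M)

  -- Where the head is, seen from a cell or from a part of the tape.
  data Mode (A : Set) : Set where
    onLeft onRight : Mode A
    inside : A → Mode A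

  -- Cell μ a X Y: what remains to happen on a single cell containing a, where
  -- X and Y are the remaining crossing sequences on its left and right
  -- boundary.  The head may stay inside the cell at the end.
  data Cell : Mode (State M) → Tape M → Word → Word → Set where
    end  : ∀ {μ a} → Cell μ a [] []
    inL  : ∀ {a q X Y} → Cell (inside q) a X Y → Cell onLeft a (q ∷ X) Y
    inR  : ∀ {a q X Y} → Cell (inside q) a X Y → Cell onRight a X (q ∷ Y)
    outL : ∀ {s a q b X Y} → Trans M s a q b left → Cell onLeft b X Y →
      Cell (inside s) a (q ∷ X) Y
    outR : ∀ {s a q b X Y} → Trans M s a q b right → Cell onRight b X Y →
      Cell (inside s) a X (q ∷ Y)

  -- With the head on the left, the cell can only be reached across its left boundary. The equation
  -- is an argument because X will be a value of a sequence.
  onLeft-[] : ∀ {a X Y} → X ≡ [] → Cell onLeft a X Y → Y ≡ []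
  onLeft-[] _ end = refl

  onRight-[] : ∀ {a X Y} → Y ≡ [] → Cell onRight a X Y → X ≡ []
  onRight-[] _ end = refl

  enterL : ∀ {a q X X′ Y} → X ≡ q ∷ X′ → Cell onLeft a X Y → Cell (inside q) a X′ Y
  enterL refl (inL d) = d

  enterR : ∀ {a q X Y Y′} → Y ≡ q ∷ Y′ → Cell onRight a X Y → Cell (inside q) a X Y′
  enterR refl (inR d) = d

  -- Crossing sequences relative to the head: rightSeq k and leftSeq k belong to
  -- the (k+1)-st boundary to the right and to the left of the head.
  mutual
    rightSeq : List (Move M) → ℕ → Word
    rightSeq [] _ = []
    rightSeq ((q , _ , right) ∷ ms) zero = q ∷ leftSeq ms 0
    rightSeq ((q , _ , right) ∷ ms) (suc k) = rightSeq ms k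
    rightSeq ((q , _ , left) ∷ ms) k = rightSeq ms (suc k)

    leftSeq : List (Move M) → ℕ → Word
    leftSeq [] _ = []
    leftSeq ((q , _ , left) ∷ ms) zero = q ∷ rightSeq ms 0
    leftSeq ((q , _ , left) ∷ ms) (suc k) = leftSeq ms k
    leftSeq ((q , _ , right) ∷ ms) k = leftSeq ms (suc k)

  atHead : Config M → Tape M
  atHead (cfg t p s) = t p

  rightOf leftOf : Config M → ℕ → Tape M
  rightOf (cfg t p s) k = t (p ℤ.+ pos (suc k))
  leftOf (cfg t p s) k = t (p ℤ.+ -[1+ k ])

  write-same : ∀ t p b {x} → x ≡ p → write M t p b x ≡ b
  write-same t p b {x} e with x ℤ.≟ p
  ... | yes _ = refl
  ... | no n = ⊥-elim (n e)

  write-other : ∀ t p b {x} → x ≢ p → write M t p b x ≡ t x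
  write-other t p b {x} n with x ℤ.≟ p
  ... | yes e = ⊥-elim (n e)
  ... | no _ = refl

  +-moves : ∀ p d → d ≢ pos 0 → p ℤ.+ d ≢ p
  +-moves p d d≢0 e = d≢0 (identityʳ-unique p d e)

  module _ (t : ℤ → Tape M) (p : ℤ) (b : Tape M) where

    write-at : ∀ d e {x} → d ℤ.+ e ≡ x → x ≢ pos 0 → write M t p b (p ℤ.+ d ℤ.+ e) ≡ t (p ℤ.+ x)
    write-at d e refl n = trans
      (write-other t p b (subst (_≢ p) (sym (ℤ.+-assoc p d e)) (+-moves p (d ℤ.+ e) n)))
      (cong t (ℤ.+-assoc p d e))

    write-back : ∀ d e → d ℤ.+ e ≡ pos 0 → write M t p b (p ℤ.+ d ℤ.+ e) ≡ b
    write-back d e z = write-same t p b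
      (trans (ℤ.+-assoc p d e) (trans (cong (λ i → p ℤ.+ i) z) (ℤ.+-identityʳ p)))

  atHead-right : ∀ c q b → atHead (apply M c (q , b , right)) ≡ rightOf c 0
  atHead-right (cfg t p s) q b = write-other t p b (+-moves p (pos 1) λ ())

  atHead-left : ∀ c q b → atHead (apply M c (q , b , left)) ≡ leftOf c 0
  atHead-left (cfg t p s) q b = write-other t p b (+-moves p -[1+ 0 ] λ ())

  rightOf-right : ∀ c q b k → rightOf (apply M c (q , b , right)) k ≡ rightOf c (suc k)
  rightOf-right (cfg t p s) q b k = write-at t p b (pos 1) (pos (suc k)) refl λ ()

  leftOf-left : ∀ c q b k → leftOf (apply M c (q , b , left)) k ≡ leftOf c (suc k)
  leftOf-left (cfg t p s) q b k = write-at t p b -[1+ 0 ] -[1+ k ] refl λ ()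

  rightOf-left : ∀ c q b k → rightOf (apply M c (q , b , left)) k ≡ (b ∷ [] ▹ rightOf c) k
  rightOf-left (cfg t p s) q b zero = write-back t p b -[1+ 0 ] (pos 1) refl
  rightOf-left (cfg t p s) q b (suc k) = write-at t p b -[1+ 0 ] (pos (suc (suc k))) refl λ ()

  leftOf-right : ∀ c q b k → leftOf (apply M c (q , b , right)) k ≡ (b ∷ [] ▹ leftOf c) k
  leftOf-right (cfg t p s) q b zero = write-back t p b (pos 1) -[1+ 0 ] refl
  leftOf-right (cfg t p s) q b (suc k) = write-at t p b (pos 1) -[1+ suc k ] refl λ ()

  -- A purely local condition: neighbouring cells are linked only by the word on their common
  -- boundary. Both sequences are numbered outward from the head.
  record Cellwise (c : Config M) (L R : ℕ → Word) : Set where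
    field
      onHead   : Cell (inside (Config.st c)) (atHead c) (L 0) (R 0)
      onRights : ∀ k → Cell onLeft (rightOf c k) (R k) (R (suc k))
      onLefts  : ∀ k → Cell onRight (leftOf c k) (L (suc k)) (L k)
  open Cellwise

  retape : ∀ {μ a b X Y} → a ≡ b → Cell μ a X Y → Cell μ b X Y
  retape refl d = d

  -- A move prepends one state to the boundary it crosses and shifts the numbering by one; the cell
  -- just left becomes the nearest one on the other side.
  run⇒cellwise : ∀ c ms → ValidFrom M c ms → Cellwise c (leftSeq ms) (rightSeq ms)
  run⇒cellwise c [] v = record { onHead = end ; onRights = λ _ → end ; onLefts = λ _ → end }
  run⇒cellwise c@(cfg t p s) ((q , b , right) ∷ ms) (a , v) = record
    { onHead = outR a (retape (leftOf-right c q b 0) (onLefts J 0))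
    ; onRights = λ where
        zero → inL (retape (atHead-right c q b) (onHead J))
        (suc k) → retape (rightOf-right c q b k) (onRights J k)
    ; onLefts = λ k → retape (leftOf-right c q b (suc k)) (onLefts J (suc k)) }
    where J = run⇒cellwise (apply M c (q , b , right)) ms v
  run⇒cellwise c@(cfg t p s) ((q , b , left) ∷ ms) (a , v) = record
    { onHead = outL a (retape (rightOf-left c q b 0) (onRights J 0))
    ; onRights = λ k → retape (rightOf-left c q b (suc k)) (onRights J (suc k))
    ; onLefts = λ where
        zero → inR (retape (atHead-left c q b) (onHead J))
        (suc k) → retape (leftOf-left c q b k) (onLefts J k) }
    where J = run⇒cellwise (apply M c (q , b , left)) ms v

  -- Inversion of a cell with the head inside, with equations in place of indices so that it applies
  -- to `L 0` and `R 0`.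
  data Exit (s : State M) (a : Tape M) (X Y : Word) : Set where
    stay : X ≡ [] → Y ≡ [] → Exit s a X Y
    toL : ∀ {q b X′} → X ≡ q ∷ X′ → Trans M s a q b left → Cell onLeft b X′ Y → Exit s a X Y
    toR : ∀ {q b Y′} → Y ≡ q ∷ Y′ → Trans M s a q b right → Cell onRight b X Y′ → Exit s a X Y

  exit : ∀ {s a X Y} → Cell (inside s) a X Y → Exit s a X Y
  exit end = stay refl refl
  exit (outL tr d) = toL refl tr d
  exit (outR tr d) = toR refl tr d

  -- The fuel N replaces a termination measure on the infinitely many cells.
  cellwise⇒run : ∀ N c L R → Cellwise c L R → Σ[ ms ∈ List (Move M) ] ValidFrom M c ms ×
    (length ms ≡ N ⊎ ((∀ k → leftSeq ms k ≡ L k) × (∀ k → rightSeq ms k ≡ R k)))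
  cellwise⇒run zero c L R J = [] , tt , inj₁ refl
  cellwise⇒run (suc N) c@(cfg t p s) L R J with exit (onHead J)
  ... | stay l₀ r₀ = [] , tt , inj₂ (lefts , rights)
    where
    -- Emptiness of the two boundaries at the head spreads outward from cell to cell.
    lefts : ∀ k → [] ≡ L k
    lefts zero = sym l₀
    lefts (suc k) = sym (onRight-[] (sym (lefts k)) (onLefts J k))
    rights : ∀ k → [] ≡ R k
    rights zero = sym r₀
    rights (suc k) = sym (onLeft-[] (sym (rights k)) (onRights J k))
  ... | toR {q} {b} {Y′} e tr d = conclude (cellwise⇒run N c′ (Y′ ∷ [] ▹ L) (R ∘ suc) record
    { onHead = retape (sym (atHead-right c q b)) (enterL e (onRights J 0))
    ; onRights = λ k → retape (sym (rightOf-right c q b k)) (onRights J (suc k))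
    ; onLefts = λ where
        zero → retape (sym (leftOf-right c q b 0)) d
        (suc k) → retape (sym (leftOf-right c q b (suc k))) (onLefts J k) })
    where
    c′ = apply M c (q , b , right)
    conclude : _ → _
    conclude (ms , v , inj₁ len) = (q , b , right) ∷ ms , (tr , v) , inj₁ (cong suc len)
    conclude (ms , v , inj₂ (l , r)) = (q , b , right) ∷ ms , (tr , v) , inj₂ (l ∘ suc , λ where
      zero → trans (cong (q ∷_) (l 0)) (sym e)
      (suc k) → r k)
  ... | toL {q} {b} {X′} e tr d = conclude (cellwise⇒run N c′ (L ∘ suc) (X′ ∷ [] ▹ R) record
    { onHead = retape (sym (atHead-left c q b)) (enterR e (onLefts J 0))
    ; onRights = λ where
        zero → retape (sym (rightOf-left c q b 0)) d
        (suc k) → retape (sym (rightOf-left c q b (suc k))) (onRights J k)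
    ; onLefts = λ k → retape (sym (leftOf-left c q b k)) (onLefts J (suc k)) })
    where
    c′ = apply M c (q , b , left)
    conclude : _ → _
    conclude (ms , v , inj₁ len) = (q , b , left) ∷ ms , (tr , v) , inj₁ (cong suc len)
    conclude (ms , v , inj₂ (l , r)) = (q , b , left) ∷ ms , (tr , v) , inj₂ ((λ where
      zero → trans (cong (q ∷_) (r 0)) (sym e)
      (suc k) → l k) , r ∘ suc)

  -- Absolute and head-relative numbering of boundaries.

  ≢-offset : ∀ p {d e} → d ≢ e → p ℤ.+ d ≢ p ℤ.+ e
  ≢-offset p d≢e = d≢e ∘ ∙-cancelˡ p _ _

  1≢-k : ∀ k → pos 1 ≢ ℤ.- pos k
  1≢-k zero ()
  1≢-k (suc k) ()

  mutual
    -- Boundary b is the left edge of cell b. Hence the offset from p is k + 1 for the (k+1)-st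
    -- boundary to the right, but only -k for the (k+1)-st to the left.
    crossSeq-rightSeq : ∀ ms p k {b} → p ℤ.+ pos (suc k) ≡ b → crossSeq M b p ms ≡ rightSeq ms k
    crossSeq-rightSeq [] p k e = refl
    crossSeq-rightSeq ((q , _ , right) ∷ ms) p zero {b} e
      rewrite dec-true (p ℤ.+ pos 1 ℤ.≟ b) e =
      cong (q ∷_) (crossSeq-leftSeq ms _ 0 (trans (ℤ.+-identityʳ _) e))
    crossSeq-rightSeq ((q , _ , right) ∷ ms) p (suc k) {b} e
      rewrite dec-false (p ℤ.+ pos 1 ℤ.≟ b) (subst (p ℤ.+ pos 1 ≢_) e (≢-offset p λ ())) =
      crossSeq-rightSeq ms _ k (trans (ℤ.+-assoc p (pos 1) (pos (suc k))) e)
    crossSeq-rightSeq ((q , _ , left) ∷ ms) p k {b} e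
      rewrite dec-false (p ℤ.≟ b) (λ e′ → +-moves p (pos (suc k)) (λ ()) (trans e (sym e′))) =
      crossSeq-rightSeq ms _ (suc k) (trans (ℤ.+-assoc p -[1+ 0 ] (pos (suc (suc k)))) e)

    crossSeq-leftSeq : ∀ ms p k {b} → p ℤ.+ ℤ.- pos k ≡ b → crossSeq M b p ms ≡ leftSeq ms k
    crossSeq-leftSeq [] p k e = refl
    crossSeq-leftSeq ((q , _ , left) ∷ ms) p zero {b} e
      rewrite dec-true (p ℤ.≟ b) (trans (sym (ℤ.+-identityʳ p)) e) =
      cong (q ∷_) (crossSeq-rightSeq ms _ 0 (trans (ℤ.+-assoc p -[1+ 0 ] (pos 1)) e))
    crossSeq-leftSeq ((q , _ , left) ∷ ms) p (suc k) {b} e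
      rewrite dec-false (p ℤ.≟ b) (λ e′ → +-moves p -[1+ k ] (λ ()) (trans e (sym e′))) =
      crossSeq-leftSeq ms _ k (trans (ℤ.+-assoc p -[1+ 0 ] (ℤ.- pos k)) (trans (cong (λ i → p ℤ.+ i) (back k)) e))
      where
      back : ∀ k → -[1+ 0 ] ℤ.+ ℤ.- pos k ≡ -[1+ k ]
      back zero = refl
      back (suc k) = refl
    crossSeq-leftSeq ((q , _ , right) ∷ ms) p k {b} e
      rewrite dec-false (p ℤ.+ pos 1 ℤ.≟ b) (subst (p ℤ.+ pos 1 ≢_) e (≢-offset p (1≢-k k))) =
      crossSeq-leftSeq ms _ (suc k) (trans (ℤ.+-assoc p (pos 1) -[1+ k ]) (trans (cong (λ i → p ℤ.+ i) (forth k)) e))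
      where
      forth : ∀ k → pos 1 ℤ.+ -[1+ k ] ≡ ℤ.- pos k
      forth zero = refl
      forth (suc k) = refl

  -- The number of steps as a total of crossings.

  weight : List Word → ℕ
  weight = sum ∘ map length

  windowWeight : List (Move M) → ℕ → ℕ → ℕ
  windowWeight ms j k = weight (applyUpTo (leftSeq ms) j) + weight (applyUpTo (rightSeq ms) k)

  weight-zeros : ∀ k → weight (applyUpTo (λ _ → []) k) ≡ 0
  weight-zeros zero = refl
  weight-zeros (suc k) = weight-zeros k

  swap-front : ∀ a b c → a + suc (b + c) ≡ suc (b + a + c)
  swap-front = solve-∀

  windowWeight-right : ∀ q b ms j k →
    windowWeight ((q , b , right) ∷ ms) j (suc k) ≡ suc (windowWeight ms (suc j) k)
  windowWeight-right q b ms j k =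
    swap-front (weight (applyUpTo (leftSeq ms ∘ suc) j)) (length (leftSeq ms 0)) _

  windowWeight-left : ∀ q b ms j k →
    windowWeight ((q , b , left) ∷ ms) (suc j) k ≡ suc (windowWeight ms j (suc k))
  windowWeight-left q b ms j k = cong suc
    (trans (cong (_+ outer) (+-comm r inner)) (+-assoc inner r outer))
    where
    r = length (rightSeq ms 0)
    inner = weight (applyUpTo (leftSeq ms) j)
    outer = weight (applyUpTo (rightSeq ms ∘ suc) k)

  -- Every step crosses exactly one boundary, so it is counted at most once.
  windowWeight≤ : ∀ ms j k → windowWeight ms j k ≤ length ms
  windowWeight≤ [] j k = ≤-reflexive (cong₂ _+_ (weight-zeros j) (weight-zeros k))
  windowWeight≤ ((q , b , right) ∷ ms) j (suc k) =
    ≤-trans (≤-reflexive (windowWeight-right q b ms j k)) (s≤s (windowWeight≤ ms (suc j) k))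
  windowWeight≤ ((q , b , right) ∷ ms) j zero =
    ≤-trans (+-monoˡ-≤ 0 (m≤n+m _ (length (leftSeq ms 0)))) (m≤n⇒m≤1+n (windowWeight≤ ms (suc j) 0))
  windowWeight≤ ((q , b , left) ∷ ms) (suc j) k =
    ≤-trans (≤-reflexive (windowWeight-left q b ms j k)) (s≤s (windowWeight≤ ms j (suc k)))
  windowWeight≤ ((q , b , left) ∷ ms) zero k =
    ≤-trans (m≤n+m _ (length (rightSeq ms 0))) (m≤n⇒m≤1+n (windowWeight≤ ms 0 (suc k)))

  -- A run of N steps crosses only the N nearest boundaries on either side of its start, so a window
  -- that wide misses no step.
  length≤windowWeight : ∀ ms j k → length ms ≤ j → length ms ≤ k → length ms ≤ windowWeight ms j k
  length≤windowWeight [] j k _ _ = z≤n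
  length≤windowWeight ((q , b , right) ∷ ms) j (suc k) ≤j (s≤s ≤k) =
    ≤-trans (s≤s (length≤windowWeight ms (suc j) k (m≤n⇒m≤1+n (≤-trans (n≤1+n _) ≤j)) ≤k))
      (≤-reflexive (sym (windowWeight-right q b ms j k)))
  length≤windowWeight ((q , b , left) ∷ ms) (suc j) k (s≤s ≤j) ≤k =
    ≤-trans (s≤s (length≤windowWeight ms j (suc k) ≤j (m≤n⇒m≤1+n (≤-trans (n≤1+n _) ≤k))))
      (≤-reflexive (sym (windowWeight-left q b ms j k)))

  -- Paths of input cells and their surroundings.

  initTape-suc : ∀ {n} a (w : Vec (Sym M) n) k →
    initTape M (a ∷ w) (pos (suc k)) ≡ initTape M w (pos k)
  initTape-suc {n} a w k with suc k ℕ.<? suc n | k ℕ.<? n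
  ... | yes p | yes p′ = cong (λ i → inp (lookup w i)) (Fin.fromℕ<-cong k k refl _ p′)
  ... | yes p | no ¬p = ⊥-elim (¬p (≤-pred p))
  ... | no ¬p | yes p = ⊥-elim (¬p (s≤s p))
  ... | no _ | no _ = refl

  initTape-fromList : ∀ u k → initTape M (fromList u) (pos k) ≡ (map inp u ▹ const blank) k
  initTape-fromList [] k = refl
  initTape-fromList (a ∷ u) zero = refl
  initTape-fromList (a ∷ u) (suc k) = trans (initTape-suc a (fromList u) k) (initTape-fromList u k)

  -- A stretch of the tape with input letters u, entered from the left.  The
  -- boundary to the left of the k-th letter has the k-th word of vs as its
  -- crossing sequence, the boundary to the right of the last letter has Z.
  data Path : Word → List (Sym M) → List Word → Word → Set where
    []  : ∀ {X} → Path X [] [] X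
    _∷_ : ∀ {a u X Y Z vs} → Cell onLeft (inp a) X Y → Path Y u vs Z →
      Path X (a ∷ u) (X ∷ vs) Z

  _++ₚ_ : ∀ {X Y Z u u′ vs vs′} → Path X u vs Y → Path Y u′ vs′ Z → Path X (u ++ u′) (vs ++ vs′) Z
  [] ++ₚ P′ = P′
  (d ∷ P) ++ₚ P′ = d ∷ (P ++ₚ P′)

  path-length : ∀ {X u vs Z} → Path X u vs Z → length vs ≡ length u
  path-length [] = refl
  path-length (d ∷ P) = cong suc (path-length P)

  path-split : ∀ {X u Z} vs vs′ → Path X u (vs ++ vs′) Z →
    ∃[ Y ] ∃[ u₁ ] ∃[ u₂ ] Path X u₁ vs Y × Path Y u₂ vs′ Z
  path-split [] vs′ P = _ , _ , _ , [] , P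
  path-split (v ∷ vs) vs′ (d ∷ P) with path-split vs vs′ P
  ... | Y , u₁ , u₂ , P₁ , P₂ = Y , _ , u₂ , d ∷ P₁ , P₂

  path-splitAt : ∀ {X u Z} vs {f} k → Path X u vs Z → f 0 ≡ Z → k ≤ length vs →
    ∃[ u₁ ] ∃[ u₂ ] ∃[ vs₁ ] ∃[ vs₂ ] Path X u₁ vs₁ ((vs ▹ f) k) × Path ((vs ▹ f) k) u₂ vs₂ Z
  path-splitAt [] zero [] refl _ = _ , _ , _ , _ , [] , []
  path-splitAt (v ∷ vs) zero P@(_ ∷ _) e _ = _ , _ , _ , _ , [] , P
  path-splitAt (v ∷ vs) (suc k) (d ∷ P) e (s≤s k≤) with path-splitAt vs k P e k≤
  ... | u₁ , u₂ , vs₁ , vs₂ , P₁ , P₂ = _ , u₂ , _ , vs₂ , d ∷ P₁ , P₂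

  cells⇒path : ∀ u (X : ℕ → Word) →
    (∀ k → Cell onLeft ((map inp u ▹ const blank) k) (X k) (X (suc k))) →
    Path (X 0) u (applyUpTo X (length u)) (X (length u))
  cells⇒path [] X cs = []
  cells⇒path (a ∷ u) X cs = cs 0 ∷ cells⇒path u (X ∘ suc) (cs ∘ suc)

  path⇒cells : ∀ {X u vs Z f} → Path X u vs Z → f 0 ≡ Z →
    (∀ k → Cell onLeft blank (f k) (f (suc k))) →
    (vs ▹ f) 0 ≡ X × (∀ k → Cell onLeft ((map inp u ▹ const blank) k) ((vs ▹ f) k) ((vs ▹ f) (suc k)))
  path⇒cells [] e cs = e , cs
  path⇒cells (d ∷ P) e cs with path⇒cells P e cs
  ... | e′ , cs′ = refl , λ where
    zero → subst (Cell onLeft _ _) (sym e′) d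
    (suc k) → cs′ k

  -- Everything but a stretch of input letters to the right of the starting cell.
  record Ends (a₀ : Sym M) (X Z : Word) : Set where
    field
      lefts rights : ℕ → Word
      rights-first : rights 0 ≡ Z
      leftCells    : ∀ k → Cell onRight blank (lefts (suc k)) (lefts k)
      startCell    : Cell (inside q₀) (inp a₀) (lefts 0) X
      rightCells   : ∀ k → Cell onLeft blank (rights k) (rights (suc k))
  open Ends

  start : Sym M → List (Sym M) → Config M
  start a₀ u = initConfig M (fromList (a₀ ∷ u))

  cells-from : ∀ u (X : ℕ → Word) →
    (∀ k → Cell onLeft ((map inp u ▹ const blank) k) (X k) (X (suc k))) →
    ∀ k → Cell onLeft blank (X (length u + k)) (X (suc (length u + k)))
  cells-from [] X cs k = cs k
  cells-from (a ∷ u) X cs k = cells-from u (X ∘ suc) (cs ∘ suc) k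

  ▹-applyUpTo : ∀ {A : Set} (f : ℕ → A) n k → (applyUpTo f n ▹ (λ j → f (n + j))) k ≡ f k
  ▹-applyUpTo f zero k = refl
  ▹-applyUpTo f (suc n) zero = refl
  ▹-applyUpTo f (suc n) (suc k) = ▹-applyUpTo (f ∘ suc) n k

  -- The first letter goes into `Ends` because the head starts inside its cell; the other input
  -- cells begin with the head on their left, as `Path` demands.
  run⇒path : ∀ a₀ u ms → ValidFrom M (start a₀ u) ms →
    ∃[ X ] ∃[ Z ] ∃[ vs ] Σ[ E ∈ Ends a₀ X Z ] Path X u vs Z ×
      (∀ k → leftSeq ms k ≡ lefts E k) × (∀ k → rightSeq ms k ≡ (vs ▹ rights E) k)
  run⇒path a₀ u ms v = _ , _ , _ , E , cells⇒path u (rightSeq ms) cs , (λ _ → refl)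
    , λ k → sym (▹-applyUpTo (rightSeq ms) (length u) k)
    where
    J = run⇒cellwise (start a₀ u) ms v
    cs : ∀ k → Cell onLeft ((map inp u ▹ const blank) k) (rightSeq ms k) (rightSeq ms (suc k))
    cs k = retape (initTape-fromList (a₀ ∷ u) (suc k)) (Cellwise.onRights J k)
    E : Ends a₀ (rightSeq ms 0) (rightSeq ms (length u))
    E = record
      { lefts = leftSeq ms
      ; rights = λ k → rightSeq ms (length u + k)
      ; rights-first = cong (rightSeq ms) (+-identityʳ _)
      ; leftCells = Cellwise.onLefts J
      ; startCell = Cellwise.onHead J
      ; rightCells = λ k → subst (Cell onLeft blank _) (cong (rightSeq ms) (sym (+-suc _ k)))
          (cells-from u (rightSeq ms) cs k) }

  path⇒run : ∀ {a₀ X Z u vs T} (E : Ends a₀ X Z) → Path X u vs Z →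
    (∀ ms → ValidFrom M (start a₀ u) ms → length ms ≤ T) →
    Σ[ ms ∈ List (Move M) ] ValidFrom M (start a₀ u) ms ×
      (∀ k → leftSeq ms k ≡ lefts E k) × (∀ k → rightSeq ms k ≡ (vs ▹ rights E) k)
  path⇒run {a₀} {u = u} {vs} {T} E P bound with path⇒cells P (rights-first E) (rightCells E)
  -- Running out of fuel T + 1 would yield a run of T + 1 steps, against the bound.
  ... | e , cs with cellwise⇒run (suc T) (start a₀ u) (lefts E) (vs ▹ rights E) record
    { onHead = subst (Cell _ _ _) (sym e) (startCell E)
    ; onRights = λ k → retape (sym (initTape-fromList (a₀ ∷ u) (suc k))) (cs k)
    ; onLefts = leftCells E }
  ... | ms , v , inj₁ long = ⊥-elim (1+n≰n (subst (_≤ T) long (bound ms v)))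
  ... | ms , v , inj₂ (l , r) = ms , v , l , r

  weight-++ : ∀ vs vs′ → weight (vs ++ vs′) ≡ weight vs + weight vs′
  weight-++ = sum-map-++ length

  weight-applyUpTo-cong : ∀ {f g : ℕ → Word} → (∀ k → f k ≡ g k) →
    ∀ n → weight (applyUpTo f n) ≡ weight (applyUpTo g n)
  weight-applyUpTo-cong e zero = refl
  weight-applyUpTo-cong e (suc n) = cong₂ _+_ (cong length (e 0)) (weight-applyUpTo-cong (e ∘ suc) n)

  weight-▹ : ∀ vs f n → weight (applyUpTo (vs ▹ f) (length vs + n)) ≡ weight vs + weight (applyUpTo f n)
  weight-▹ [] f n = refl
  weight-▹ (v ∷ vs) f n = trans (cong (length v +_) (weight-▹ vs f n)) (sym (+-assoc (length v) _ _))

  module _ {a₀ X Z} (E : Ends a₀ X Z) where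

    HasCrossings : List Word → List (Move M) → Set
    HasCrossings vs ms = (∀ k → leftSeq ms k ≡ lefts E k) × (∀ k → rightSeq ms k ≡ (vs ▹ rights E) k)

    windowWeight-path : ∀ vs ms → HasCrossings vs ms → ∀ j k →
      windowWeight ms j (length vs + k) ≡
      weight vs + (weight (applyUpTo (lefts E) j) + weight (applyUpTo (rights E) k))
    windowWeight-path vs ms (l , r) j k = begin
      windowWeight ms j (length vs + k)
        ≡⟨ cong₂ _+_ (weight-applyUpTo-cong l j)
             (trans (weight-applyUpTo-cong r (length vs + k)) (weight-▹ vs (rights E) k)) ⟩
      A + (weight vs + B)   ≡⟨ +-assoc A (weight vs) B ⟨
      A + weight vs + B     ≡⟨ cong (_+ B) (+-comm A (weight vs)) ⟩
      weight vs + A + B     ≡⟨ +-assoc (weight vs) A B ⟩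
      weight vs + (A + B)   ∎
      where
      open ≡-Reasoning
      A = weight (applyUpTo (lefts E) j)
      B = weight (applyUpTo (rights E) k)

    weight≤length : ∀ vs ms → HasCrossings vs ms → weight vs ≤ length ms
    weight≤length vs ms h = ≤-trans (m≤m+n (weight vs) 0)
      (≤-trans (≤-reflexive (sym (windowWeight-path vs ms h 0 0))) (windowWeight≤ ms 0 (length vs + 0)))

    -- Outside the path both runs have the same crossings, so their lengths differ as the weights
    -- do. A window reaching `length ms` boundaries beyond the path counts all of `ms` and never
    -- overcounts `ms′`.
    length-exchange : ∀ vs ms vs′ ms′ → HasCrossings vs ms → HasCrossings vs′ ms′ →
      length ms + weight vs′ ≤ length ms′ + weight vs
    length-exchange vs ms vs′ ms′ h h′ = begin
      length ms + weight vs′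
        ≤⟨ +-monoˡ-≤ _ (length≤windowWeight ms N (length vs + N) ≤-refl (m≤n+m N (length vs))) ⟩
      windowWeight ms N (length vs + N) + weight vs′
        ≡⟨ cong (_+ weight vs′) (windowWeight-path vs ms h N N) ⟩
      weight vs + W + weight vs′   ≡⟨ +-assoc (weight vs) W (weight vs′) ⟩
      weight vs + (W + weight vs′) ≡⟨ cong (weight vs +_) (+-comm W (weight vs′)) ⟩
      weight vs + (weight vs′ + W)
        ≡⟨ cong (weight vs +_) (windowWeight-path vs′ ms′ h′ N N) ⟨
      weight vs + windowWeight ms′ N (length vs′ + N)
        ≤⟨ +-monoʳ-≤ (weight vs) (windowWeight≤ ms′ N (length vs′ + N)) ⟩
      weight vs + length ms′       ≡⟨ +-comm (weight vs) (length ms′) ⟩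
      length ms′ + weight vs ∎
      where
      open ≤-Reasoning
      N = length ms
      W = weight (applyUpTo (lefts E) N) + weight (applyUpTo (rights E) N)

  path-weight≤ : ∀ {a₀ X Z u vs T} → Ends a₀ X Z → Path X u vs Z →
    (∀ ms → ValidFrom M (start a₀ u) ms → length ms ≤ T) → weight vs ≤ T
  path-weight≤ {vs = vs} E P bound with path⇒run E P bound
  ... | ms , v , h = ≤-trans (weight≤length E vs ms h) (bound ms v)

-- Computations on a part as paths of cells.

module Parts (M : NTM) where
  open NTM M
  open Cells M

  -- The analogue of Cell for a part of m + 1 cells.  Unlike in PRun, leaving
  -- the part and entering it again are separate steps.
  data Part {m : ℕ} : Mode (Fin (suc m) × State M) → Vec (Tape M) (suc m) → Word → Word → Set where
    end  : ∀ {μ tp} → Part μ tp [] []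
    inL  : ∀ {tp q X Y} → Part (inside (zero , q)) tp X Y → Part onLeft tp (q ∷ X) Y
    inR  : ∀ {tp q X Y} → Part (inside (fromℕ m , q)) tp X Y → Part onRight tp X (q ∷ Y)
    outL : ∀ {tp s q b X Y} → Trans M s (lookup tp zero) q b left →
      Part onLeft (tp [ zero ]≔ b) X Y → Part (inside (zero , s)) tp (q ∷ X) Y
    outR : ∀ {tp s q b X Y} → Trans M s (lookup tp (fromℕ m)) q b right →
      Part onRight (tp [ fromℕ m ]≔ b) X Y → Part (inside (fromℕ m , s)) tp X (q ∷ Y)
    internal : ∀ {tp i j s q b X Y} d → Trans M s (lookup tp i) q b d → Adjacent M d i j →
      Part (inside (j , q)) (tp [ i ]≔ b) X Y → Part (inside (i , s)) tp X Y

  innerSeq : ∀ {m μ X Y} {tp : Vec (Tape M) (suc m)} → ℕ → Part μ tp X Y → Word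
  innerSeq j end = []
  innerSeq j (inL r) = innerSeq j r
  innerSeq j (inR r) = innerSeq j r
  innerSeq j (outL _ r) = innerSeq j r
  innerSeq j (outR _ r) = innerSeq j r
  innerSeq j (internal {i = i} {q = q} right _ _ r) =
    (if does (suc (toℕ i) ℕ.≟ j) then q ∷ [] else []) ++ innerSeq j r
  innerSeq j (internal {i = i} {q = q} left _ _ r) =
    (if does (toℕ i ℕ.≟ j) then q ∷ [] else []) ++ innerSeq j r

  prun⇒part : ∀ {m ql} {c : PConf M m} → PRun M ql c →
    let open PConf c in Part (inside (ppos , pst)) ptape C₁ C₂
  prun⇒part (finish (leftE tr)) = outL tr end
  prun⇒part (finish (rightE tr)) = outR tr end
  prun⇒part (internal d tr adj ▸ r) = internal d tr adj (prun⇒part r)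
  prun⇒part (leftB tr ▸ r) = outL tr (inL (prun⇒part r))
  prun⇒part (rightB tr ▸ r) = outR tr (inR (prun⇒part r))

  innerSeq-prun⇒part : ∀ {m ql} {c : PConf M m} j (r : PRun M ql c) →
    innerSeq j (prun⇒part r) ≡ pcross M j r
  innerSeq-prun⇒part j (finish (leftE tr)) = refl
  innerSeq-prun⇒part j (finish (rightE tr)) = refl
  innerSeq-prun⇒part j (internal right tr adj ▸ r) = cong (_ ++_) (innerSeq-prun⇒part j r)
  innerSeq-prun⇒part j (internal left tr adj ▸ r) = cong (_ ++_) (innerSeq-prun⇒part j r)
  innerSeq-prun⇒part j (leftB tr ▸ r) = innerSeq-prun⇒part j r
  innerSeq-prun⇒part j (rightB tr ▸ r) = innerSeq-prun⇒part j r

  odd : Word → Bool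
  odd [] = false
  odd (_ ∷ X) = not (odd X)

  -- Both remaining sequences of a part computation end in the same state; an exhausted one imposes
  -- nothing.
  LastIs : State M → Word → Set
  LastIs ql [] = ⊤
  LastIs ql (q ∷ X) = lastOf M q X ≡ ql

  lastIs-tail : ∀ {ql} q X → LastIs ql (q ∷ X) → LastIs ql X
  lastIs-tail q [] e = tt
  lastIs-tail q (_ ∷ _) e = e

  -- By parity, the head is outside of the part at the end.
  part⇒prun : ∀ {m ql i s X Y} {tp : Vec (Tape M) (suc m)} (r : Part (inside (i , s)) tp X Y) →
    odd X xor odd Y ≡ true → LastIs ql X → LastIs ql Y →
    Σ[ r′ ∈ PRun M ql (pcfg X tp i s Y) ] (∀ j → pcross M j r′ ≡ innerSeq j r)
  part⇒prun end () _ _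
  part⇒prun (outL tr end) _ refl _ = finish (leftE tr) , λ _ → refl
  part⇒prun {Y = Y} (outL tr (inL {q = q} {X = X} r)) o l₁ l₂
    with part⇒prun r (trans (cong (_xor odd Y) (sym (not-involutive (odd X)))) o) (lastIs-tail q X l₁) l₂
  ... | r′ , e = leftB tr ▸ r′ , e
  part⇒prun (outR tr end) _ _ refl = finish (rightE tr) , λ _ → refl
  part⇒prun {X = X} (outR tr (inR {q = q} {Y = Y} r)) o l₁ l₂
    with part⇒prun r (trans (cong (odd X xor_) (sym (not-involutive (odd Y)))) o) l₁ (lastIs-tail q Y l₂)
  ... | r′ , e = rightB tr ▸ r′ , e
  part⇒prun (internal right tr adj r) o l₁ l₂ with part⇒prun r o l₁ l₂
  ... | r′ , e = internal right tr adj ▸ r′ , λ j → cong (_ ++_) (e j)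
  part⇒prun (internal left tr adj r) o l₁ l₂ with part⇒prun r o l₁ l₂
  ... | r′ , e = internal left tr adj ▸ r′ , λ j → cong (_ ++_) (e j)

  cellMode : ∀ {m} → Mode (Fin (suc m) × State M) → Mode (State M)
  cellMode onLeft = onLeft
  cellMode onRight = onRight
  cellMode (inside (zero , s)) = inside s
  cellMode (inside (suc i , s)) = onRight

  restMode : ∀ {m} → Mode (Fin (suc (suc m)) × State M) → Mode (Fin (suc m) × State M)
  restMode onLeft = onLeft
  restMode onRight = onRight
  restMode (inside (zero , s)) = onLeft
  restMode (inside (suc i , s)) = inside (i , s)

  singleton⇒cell : ∀ {μ a X Y} → Part {0} μ (a ∷ []) X Y → Cell (cellMode μ) a X Y
  singleton⇒cell end = end
  singleton⇒cell (inL r) = inL (singleton⇒cell r)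
  singleton⇒cell (inR r) = inR (singleton⇒cell r)
  singleton⇒cell (outL tr r) = outL tr (singleton⇒cell r)
  singleton⇒cell (outR tr r) = outR tr (singleton⇒cell r)
  singleton⇒cell (internal {i = zero} {j = zero} right tr () r)
  singleton⇒cell (internal {i = zero} {j = zero} left tr () r)

  cell⇒singleton : ∀ {a X Y} μ → Cell (cellMode μ) a X Y → Part {0} μ (a ∷ []) X Y
  cell⇒singleton onLeft end = end
  cell⇒singleton onLeft (inL d) = inL (cell⇒singleton _ d)
  cell⇒singleton onRight end = end
  cell⇒singleton onRight (inR d) = inR (cell⇒singleton _ d)
  cell⇒singleton (inside (zero , s)) end = end
  cell⇒singleton (inside (zero , s)) (outL tr d) = outL tr (cell⇒singleton _ d)
  cell⇒singleton (inside (zero , s)) (outR tr d) = outR tr (cell⇒singleton _ d)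

  module _ {m : ℕ} where

    Rest : ∀ {μ X Z a} {tp : Vec (Tape M) (suc m)} → Part μ (a ∷ tp) X Z → Set
    Rest {μ} {X} {Z} {a} {tp} r = Σ[ r′ ∈ Part (restMode μ) tp (innerSeq 1 r) Z ]
      (∀ j → innerSeq (suc j) r′ ≡ innerSeq (suc (suc j)) r)

    -- A move across the first inner boundary becomes an exit on one side of it and an entry on the
    -- other; all other moves belong to one side only.
    peel : ∀ {μ X Z a} {tp : Vec (Tape M) (suc m)} (r : Part μ (a ∷ tp) X Z) →
      Cell (cellMode μ) a X (innerSeq 1 r) × Rest r
    peel end = end , end , λ _ → refl
    peel (inL r) with peel r
    ... | d , r′ , e = inL d , r′ , e
    peel (inR r) with peel r
    ... | d , r′ , e = d , inR r′ , e
    peel (outL tr r) with peel r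
    ... | d , r′ , e = outL tr d , r′ , e
    peel (outR tr r) with peel r
    ... | d , r′ , e = d , outR tr r′ , e
    peel (internal {i = zero} {j = suc zero} right tr refl r) with peel r
    ... | d , r′ , e = outR tr d , inL r′ , e
    peel (internal {i = suc i} {j = suc j} right tr adj r) with peel r
    ... | d , r′ , e = d , internal right tr (suc-injective adj) r′ , λ k → cong (_ ++_) (e k)
    peel (internal {i = suc zero} {j = zero} left tr refl r) with peel r
    ... | d , r′ , e = inR d , outL tr r′ , e
    peel (internal {i = suc (suc i)} {j = suc j} left tr adj r) with peel r
    ... | d , r′ , e = d , internal left tr (suc-injective adj) r′ , λ k → cong (_ ++_) (e k)

    -- The position of the head decides which side moves next. Whenever it crosses the common
    -- boundary, the next state of Y is used up on both sides at once.
    glue : ∀ {X Y Z a} {tp : Vec (Tape M) (suc m)} μ →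
      Cell (cellMode μ) a X Y → (r′ : Part (restMode μ) tp Y Z) →
      Σ[ r ∈ Part μ (a ∷ tp) X Z ] innerSeq 1 r ≡ Y ×
        (∀ j → innerSeq (suc (suc j)) r ≡ innerSeq (suc j) r′)
    glue onLeft end end = end , refl , λ _ → refl
    glue onLeft (inL d) r with glue (inside (zero , _)) d r
    ... | r′ , e = inL r′ , e
    glue onRight end end = end , refl , λ _ → refl
    glue onRight d (inR r) with glue (inside (suc _ , _)) d r
    ... | r′ , e = inR r′ , e
    glue (inside (zero , s)) end end = end , refl , λ _ → refl
    glue (inside (zero , s)) (outL tr d) r with glue onLeft d r
    ... | r′ , e = outL tr r′ , e
    glue (inside (zero , s)) (outR tr d) (inL r) with glue (inside (suc zero , _)) d r
    ... | r′ , e , e′ = internal right tr refl r′ , cong (_ ∷_) e , e′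
    glue (inside (suc i , s)) end end = end , refl , λ _ → refl
    glue (inside (suc _ , s)) (inR d) (outL tr r) with glue (inside (zero , _)) d r
    ... | r′ , e , e′ = internal left tr refl r′ , cong (_ ∷_) e , e′
    glue (inside (suc _ , s)) d (outR tr r) with glue onRight d r
    ... | r′ , e = outR tr r′ , e
    glue (inside (suc i , s)) d (internal right tr adj r) with glue (inside (suc _ , _)) d r
    ... | r′ , e , e′ = internal right tr (cong suc adj) r′ , e , λ j → cong (_ ++_) (e′ j)
    glue (inside (suc _ , s)) d (internal {i = suc i} left tr adj r) with glue (inside (suc _ , _)) d r
    ... | r′ , e , e′ = internal left tr (cong suc adj) r′ , e , λ j → cong (_ ++_) (e′ j)

  innerWords : ∀ {m μ X Z} {tp : Vec (Tape M) (suc m)} → Part μ tp X Z → List Word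
  innerWords {m} r = applyUpTo (λ j → innerSeq (suc j) r) m

  part⇒path : ∀ {m X Z} (w : Vec (Sym M) (suc m)) (r : Part onLeft (Vec.map inp w) X Z) →
    ∃[ vs ] Path X (Vec.toList w) vs Z × weight vs ≡ length X + weight (innerWords r)
  part⇒path {zero} (a ∷ []) r = _ , singleton⇒cell r ∷ [] , refl
  part⇒path {suc m} {X} (a ∷ w) r with peel r
  ... | d , r′ , e with part⇒path w r′
  ... | vs , P , e′ = _ , d ∷ P , cong (length X +_)
    (trans e′ (cong (length (innerSeq 1 r) +_) (weight-applyUpTo-cong e m)))

  path⇒part : ∀ {X Z vs} a u → Path X (a ∷ u) vs Z →
    Σ[ r ∈ Part onLeft (Vec.map inp (fromList (a ∷ u))) X Z ]
      weight vs ≡ length X + weight (innerWords r)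
  path⇒part a [] (d ∷ []) = cell⇒singleton onLeft d , refl
  path⇒part {X} a (a′ ∷ u) (d ∷ P) with path⇒part a′ u P
  ... | r′ , e with glue onLeft d r′
  ... | r , refl , e″ = r , cong (length X +_)
    (trans e (cong (length (innerSeq 1 r) +_) (sym (weight-applyUpTo-cong e″ (length u)))))

  partLength-weight : ∀ {m} q X (w : Vec (Sym M) (suc m)) (ζ : PartComputation M w (q ∷ X)) →
    partLength M w (q ∷ X) ζ ≡ length (q ∷ X) + weight (applyUpTo (λ j → pcross M (suc j) ζ) m)
  partLength-weight {m} q X w ζ = trans (+-comm _ (length (q ∷ X))) (cong (λ xs → length (q ∷ X) + sum xs)
    (begin
      map f (map suc (upTo m))   ≡⟨ cong (map f) (map-upTo suc m) ⟩
      map f (applyUpTo suc m)    ≡⟨ map-applyUpTo suc f m ⟩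
      applyUpTo (f ∘ suc) m      ≡⟨ map-applyUpTo (λ j → pcross M (suc j) ζ) length m ⟨
      map length (applyUpTo (λ j → pcross M (suc j) ζ) m) ∎))
    where
    open ≡-Reasoning
    f : ℕ → ℕ
    f j = length (pcross M j ζ)

  partComputation⇒path : ∀ {m} (w : Vec (Sym M) (suc m)) cs (ζ : PartComputation M w cs) →
    ∃[ vs ] Path cs (Vec.toList w) vs cs × weight vs ≡ partLength M w cs ζ
  -- A part computation starts after its first entry from the left; `inL` restores that entry.
  partComputation⇒path {m} w (q ∷ X) ζ with part⇒path w (inL (prun⇒part ζ))
  ... | vs , P , e = vs , P , trans e (trans
    (cong (length (q ∷ X) +_) (weight-applyUpTo-cong (λ j → innerSeq-prun⇒part (suc j) ζ) m))
    (sym (partLength-weight q X w ζ)))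

  odd-xor : ∀ X → odd X xor not (odd X) ≡ true
  odd-xor X with odd X
  ... | true = refl
  ... | false = refl

  lastIs-self : ∀ q X → LastIs (lastOf M q X) X
  lastIs-self q [] = tt
  lastIs-self q (_ ∷ _) = refl

  path⇒partComputation : ∀ {q X vs} a u → Path (q ∷ X) (a ∷ u) vs (q ∷ X) →
    Σ[ ζ ∈ PartComputation M (fromList (a ∷ u)) (q ∷ X) ]
      partLength M (fromList (a ∷ u)) (q ∷ X) ζ ≡ weight vs
  path⇒partComputation {q} {X} a u P with path⇒part a u P
  -- After the first entry the left sequence is one shorter than the right one, so their parities
  -- differ.
  ... | inL r , e with part⇒prun r (odd-xor X) (lastIs-self q X) refl
  ... | ζ , e′ = ζ , trans (partLength-weight q X (fromList (a ∷ u)) ζ) (trans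
    (cong (length (q ∷ X) +_) (weight-applyUpTo-cong (e′ ∘ suc) (length u))) (sym e))

-- Preparations for the two implications.

data FromList {A : Set} : ∀ {n} → Vec A n → Set where
  list : ∀ xs → FromList (fromList xs)

asList : ∀ {A : Set} {n} (w : Vec A n) → FromList w
asList [] = list []
asList (x ∷ w) with asList w
... | list xs = list (x ∷ xs)

module Main (M : NTM) where
  open NTM M
  open Computations M
  open Cells M
  open Parts M

  _≟ʷ_ : DecidableEquality Word
  _≟ʷ_ = ≡-dec Fin._≟_

  open DecMembership _≟ʷ_ using (_∈?_)

  3≤nQ : 3 ≤ nQ
  3≤nQ = three q₀ qacc qrej q₀≢qacc q₀≢qrej qacc≢qrej
    where
    three : ∀ {n} (a b c : Fin n) → a ≢ b → a ≢ c → b ≢ c → 3 ≤ n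
    three {1} zero zero c a≢b _ _ = ⊥-elim (a≢b refl)
    three {2} zero zero c a≢b _ _ = ⊥-elim (a≢b refl)
    three {2} (suc zero) (suc zero) c a≢b _ _ = ⊥-elim (a≢b refl)
    three {2} zero (suc zero) zero _ a≢c _ = ⊥-elim (a≢c refl)
    three {2} zero (suc zero) (suc zero) _ _ b≢c = ⊥-elim (b≢c refl)
    three {2} (suc zero) zero zero _ _ b≢c = ⊥-elim (b≢c refl)
    three {2} (suc zero) zero (suc zero) _ a≢c _ = ⊥-elim (a≢c refl)
    three {suc (suc (suc n))} _ _ _ _ _ _ = s≤s (s≤s (s≤s z≤n))

  -- A stretch never entered from the left is never visited. This disposes of the empty crossing
  -- sequence, which has no part computations.
  path-[] : ∀ {X u vs Z} → X ≡ [] → Path X u vs Z → weight vs ≡ 0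
  path-[] e [] = refl
  path-[] refl (end ∷ P) = path-[] refl P

  path-power : ∀ {X u vs} → Path X u vs X → ∀ j → Σ[ u′ ∈ List (Sym M) ] Σ[ vs′ ∈ List Word ]
    Path X u′ vs′ X × length u′ ≡ j * length u × weight vs′ ≡ j * weight vs
  path-power P zero = [] , [] , [] , refl , refl
  path-power {u = u} {vs} P (suc j) with path-power P j
  ... | u′ , vs′ , P′ , e , e′ = u ++ u′ , vs ++ vs′ , P ++ₚ P′
    , trans (length-++ u) (cong (length u +_) e)
    , trans (weight-++ vs vs′) (cong (weight vs +_) e′)

  path-first-▹ : ∀ {X u vs Z f} → Path X u vs Z → f 0 ≡ Z → (vs ▹ f) 0 ≡ X
  path-first-▹ [] e = e
  path-first-▹ (_ ∷ _) e = refl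

  ▹-++ : ∀ {A : Set} (as bs : List A) f → (as ++ bs ▹ f) (length as) ≡ (bs ▹ f) 0
  ▹-++ [] bs f = refl
  ▹-++ (a ∷ as) bs f = ▹-++ as bs f

  boundary∈S : ∀ {a₀ X Y Z u₁ u₂ vs₁ vs₂ T} → Ends a₀ X Z → Path X u₁ vs₁ Y → Path Y u₂ vs₂ Z →
    AllRuns≤ (fromList (a₀ ∷ u₁ ++ u₂)) T → InS M (suc (length (u₁ ++ u₂))) Y
  boundary∈S {a₀} {Y = Y} {u₁ = u₁} {u₂} {vs₁} {vs₂} E p₁ p₂ bound =
    subst (InS M _) crossing
      -- The boundary number is one more than the length of the path before it, as the starting cell
      -- comes first.
      (run∈S (fromList (a₀ ∷ u₁ ++ u₂)) bound ms v (suc (length vs₁)) (s≤s z≤n) (s≤s inside-input))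
    where
    run = path⇒run E (p₁ ++ₚ p₂) bound
    ms = proj₁ run
    v = proj₁ (proj₂ run)
    crossing : crossSeq M (pos (suc (length vs₁))) (pos 0) ms ≡ Y
    crossing = trans (crossSeq-rightSeq ms (pos 0) (length vs₁) refl)
      (trans (proj₂ (proj₂ (proj₂ run)) (length vs₁))
        (trans (▹-++ vs₁ vs₂ _) (path-first-▹ p₂ (Ends.rights-first E))))
    inside-input : length vs₁ ≤ length (u₁ ++ u₂)
    inside-input = subst (_≤ length (u₁ ++ u₂)) (sym (path-length p₁)) (length-++-≤ˡ u₁)

  -- Necessity: a time bound limits the parts.

  TimeBound : ℕ → ℕ → (ℕ → Set)
  TimeBound C D n = (w : Vec (Sym M) n) → AllRuns≤ w (C * n + D)

  -- Condition (b), with the maximum unfolded into a bound on every part computation; a part without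
  -- computations satisfies it vacuously.
  SlowParts : ℕ → ℕ → ℕ → Set
  SlowParts ℓ r C = ∀ (cs : Word) → InSUpTo M ℓ cs → ∀ m (w : Vec (Sym M) (suc m)) → suc m ≤ r →
    (ζ : PartComputation M w cs) → partLength M w cs ζ ≤ C * suc m

  module _ (C D : ℕ) where

    -- Otherwise the part can be inserted arbitrarily often into an input on
    -- which cs is produced.
    bounded⇒slowParts : (∀ n → TimeBound C D n) → ∀ ℓ′ r′ → SlowParts ℓ′ r′ C
    bounded⇒slowParts bound ℓ′ r′ cs (n , _ , _ , w , i , 1≤i , i≤n , ζ , t , _ , e) m w′ _ ζ′
      with partLength M w′ cs ζ′ ≤? C * suc m
    ... | yes p = p
    ... | no ¬p with asList w
    bounded⇒slowParts bound ℓ′ r′ cs (_ , _ , _ , _ , suc k , _ , s≤s k≤ , ζ , t , _ , e) m w′ _ ζ′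
      | no ¬p | list (a₀ ∷ u)
      with run⇒path a₀ u (firstSteps M ζ t) (firstSteps-valid ζ t)
    ... | X , Z , vs , E , P , _ , r≡
      with path-splitAt vs k P (Ends.rights-first E) (subst (k ≤_) (sym (path-length P)) k≤)
         | partComputation⇒path w′ cs ζ′
    ... | u₁ , u₂ , vs₁ , vs₂ , P₁ , P₂ | vs′ , P′ , eP
      -- Each copy gains at least one step over C per cell, so one copy more than the bound for the
      -- original input suffices.
      with path-power P′ (suc (C * (1 + length u₁ + length u₂) + D))
    ... | uₚ , vsₚ , Pₚ , eu , ev = ⊥-elim (1+n≰n (too-slow (path-weight≤ E Q (bound _ _))))
      where
      cs≡ : cs ≡ (vs ▹ Ends.rights E) k
      cs≡ = trans (sym e) (trans (crossSeq-rightSeq (firstSteps M ζ t) (pos 0) k refl) (r≡ k))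
      Q : Path X (u₁ ++ uₚ ++ u₂) (vs₁ ++ vsₚ ++ vs₂) Z
      Q = subst (Path X u₁ vs₁) (sym cs≡) P₁ ++ₚ (Pₚ ++ₚ subst (λ Y → Path Y u₂ vs₂ Z) (sym cs≡) P₂)
      j B : ℕ
      B = C * (1 + length u₁ + length u₂) + D
      j = suc B
      open ≤-Reasoning
      regroup : ∀ C a b D j m → C * suc (a + (j * m + b)) + D ≡ C * (1 + a + b) + D + j * (C * m)
      regroup = solve-∀
      too-slow : weight (vs₁ ++ vsₚ ++ vs₂) ≤ C * suc (length (u₁ ++ uₚ ++ u₂)) + D → suc B ≤ B
      too-slow hi = +-cancelʳ-≤ (j * (C * suc m)) (suc B) B (begin
        j + j * (C * suc m)        ≡⟨ *-suc j (C * suc m) ⟨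
        j * suc (C * suc m)        ≤⟨ *-monoʳ-≤ j (≰⇒> ¬p) ⟩
        j * partLength M w′ cs ζ′  ≡⟨ trans ev (cong (j *_) eP) ⟨
        weight vsₚ                 ≤⟨ ≤-trans (m≤m+n (weight vsₚ) (weight vs₂)) (m≤n+m _ (weight vs₁)) ⟩
        weight vs₁ + (weight vsₚ + weight vs₂)
          ≡⟨ trans (weight-++ vs₁ _) (cong (weight vs₁ +_) (weight-++ vsₚ vs₂)) ⟨
        weight (vs₁ ++ vsₚ ++ vs₂) ≤⟨ hi ⟩
        C * suc (length (u₁ ++ uₚ ++ u₂)) + D
          ≡⟨ cong (λ n → C * suc n + D) (trans (length-++ u₁) (cong (length u₁ +_) (trans (length-++ uₚ)
               (cong (_+ length u₂) (trans eu (cong (j *_) (length-toList w′))))))) ⟩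
        C * suc (length u₁ + (j * suc m + length u₂)) + D
          ≡⟨ regroup C (length u₁) (length u₂) D j (suc m) ⟩
        B + j * (C * suc m) ∎)

    -- Sufficiency: counting on a shortest violating input.

    ℓ r P : ℕ
    ℓ = D + 8 * nQ ^ C
    r = D + 12 * nQ ^ C
    -- With C + 1 in place of C, N distinct words weigh at least C N + N - P; the extra N is what
    -- bounds their number.
    P = totalDeficit nQ (suc C)

    -- The word c may occur in `bs` again, since `reduce` jumps to last occurrences.
    Heavy : List Word → Set
    Heavy vs = ∀ as c bs zs → vs ≡ as ++ (c ∷ bs) ++ c ∷ zs → C * suc (length bs) < weight (c ∷ bs)

    heavy-suffix : ∀ as {vs} → Heavy (as ++ vs) → Heavy vs
    heavy-suffix as h as′ c bs zs refl = h (as ++ as′) c bs zs (sym (++-assoc as as′ _))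

    -- Without subtraction, `saving` says that weight minus C times length does not grow from `vs`
    -- to `words`.
    record Reduced (X : Word) (vs : List Word) (Z : Word) : Set where
      constructor reduced
      field
        {input} : List (Sym M)
        {words} : List Word
        path : Path X input words Z
        unique : Unique words
        subset : ∀ {v} → v ∈ words → v ∈ vs
        saving : C * length vs + weight words ≤ weight vs + C * length words

    -- Jumping from each word to its last occurrence removes heavy stretches only.
    reduce : ∀ n {X u vs Z} → length vs ≤ n → Heavy vs → Path X u vs Z → Reduced X vs Z
    reduce _ _ h [] = reduced [] [] (λ v∈ → v∈) (≤-reflexive (+-comm (C * 0) 0))
    reduce (suc n) {X} {vs = _ ∷ vs} (s≤s len) h (d ∷ p) with X ∈? vs
    ... | no X∉ with reduce n len (heavy-suffix (X ∷ []) h) p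
    ... | reduced {words = ws} p′ un sub sav = reduced (d ∷ p′)
      (All.tabulate (λ {v} v∈ e → X∉ (subst (_∈ vs) (sym e) (sub v∈))) ∷ un)
      (λ { (here e) → here e ; (there v∈) → there (sub v∈) })
      (begin
        C * suc (length vs) + (length X + weight ws)  ≡⟨ regroup C (length vs) (length X) (weight ws) ⟩
        C + length X + (C * length vs + weight ws)    ≤⟨ +-monoʳ-≤ (C + length X) sav ⟩
        C + length X + (weight vs + C * length ws)    ≡⟨ regroup′ C (length X) (weight vs) (length ws) ⟩
        length X + weight vs + C * suc (length ws)    ∎)
      where
      open ≤-Reasoning
      regroup : ∀ C n x w → C * suc n + (x + w) ≡ C + x + (C * n + w)
      regroup = solve-∀
      regroup′ : ∀ C x w n → C + x + (w + C * n) ≡ x + w + C * suc n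
      regroup′ = solve-∀
    reduce (suc n) {X} {vs = _ ∷ vs} (s≤s len) h (d ∷ p) | yes X∈ with lastOccurrence _≟ʷ_ vs X∈
    ... | bs , zs , refl , X∉ with path-split (X ∷ bs) (X ∷ zs) (d ∷ p)
    ... | _ , _ , _ , _ , (d′ ∷ p′)
      with reduce n (≤-trans (≤-trans (n≤1+n _) (length-++-≤ʳ (X ∷ zs) {bs})) len)
        (heavy-suffix (X ∷ bs ++ X ∷ []) (subst Heavy (cong (X ∷_) (sym (++-assoc bs (X ∷ []) zs))) h)) p′
    ... | reduced {words = ws} p″ un sub sav = reduced (d′ ∷ p″)
      (All.tabulate (λ {v} v∈ e → X∉ (subst (_∈ zs) (sym e) (sub v∈))) ∷ un)
      (λ { (here e) → here e ; (there v∈) → there (∈-++⁺ʳ bs (there (sub v∈))) })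
      (begin
        C * suc (length (bs ++ X ∷ zs)) + (x + weight ws)
          ≡⟨ cong (λ k → C * suc k + (x + weight ws)) (length-++ bs) ⟩
        C * suc (length bs + suc (length zs)) + (x + weight ws)
          ≡⟨ regroup C (length bs) (length zs) x (weight ws) ⟩
        C * suc (length bs) + (C + x + (C * length zs + weight ws))
          ≤⟨ +-mono-≤ (<⇒≤ (h [] X bs zs refl)) (+-monoʳ-≤ (C + x) sav) ⟩
        x + weight bs + (C + x + (weight zs + C * length ws))
          ≡⟨ regroup′ C x (weight bs) (weight zs) (length ws) ⟩
        x + (weight bs + (x + weight zs)) + C * suc (length ws)
          ≡⟨ cong (λ k → x + k + C * suc (length ws)) (weight-++ bs (X ∷ zs)) ⟨
        x + weight (bs ++ X ∷ zs) + C * suc (length ws) ∎)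
      where
      open ≤-Reasoning
      x = length X
      regroup : ∀ C b z x w → C * suc (b + suc z) + (x + w) ≡ C * suc b + (C + x + (C * z + w))
      regroup = solve-∀
      regroup′ : ∀ C x b z w → x + b + (C + x + (z + C * w)) ≡ x + (b + (x + z)) + C * suc w
      regroup′ = solve-∀

    -- Up to P, distinct words outweigh C per word by their number, and by `saving` this excess is
    -- at most that of `vs`.
    reduced-short : ∀ {X vs Z} (R : Reduced X vs Z) →
      length (Reduced.words R) + C * length vs ≤ weight vs + P
    reduced-short {vs = vs} (reduced {words = ws} _ un _ sav) =
      +-cancelʳ-≤ (weight ws + C * length ws) _ _ (begin
        length ws + C * length vs + (weight ws + C * length ws)
          ≡⟨ regroup (length ws) (C * length vs) (weight ws) (C * length ws) ⟩
        C * length vs + weight ws + suc C * length ws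
          ≤⟨ +-mono-≤ sav (unique⇒*-length≤ nQ (suc C) un) ⟩
        weight vs + C * length ws + (weight ws + P)
          ≡⟨ regroup′ (weight vs) (C * length ws) (weight ws) P ⟩
        weight vs + P + (weight ws + C * length ws) ∎)
      where
      open ≤-Reasoning
      regroup : ∀ a b c d → a + b + (c + d) ≡ b + c + (a + d)
      regroup = solve-∀
      regroup′ : ∀ a b c d → a + b + (c + d) ≡ a + d + (c + b)
      regroup′ = solve-∀

    -- The final estimate shared by three applications: N and W are length and weight of the whole
    -- path, and j + 1 is the number of duplicate-free lists, each costing one P.
    count : ∀ {x N W} j k → x + C * N ≤ W + suc j * P → W ≤ suc (C * suc N + D) → suc j * 3 ≤ k →
      suc x ≤ D + k * nQ ^ C
    count {x} {N} {W} j k lo hi j≤k = begin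
      suc x                                   ≤⟨ s≤s bound ⟩
      suc (suc (C + D) + suc j * P)           ≡⟨ regroup C D P j ⟩
      D + (P + (C + 2) + j * P)               ≤⟨ +-monoʳ-≤ D (+-monoʳ-≤ (P + (C + 2)) (*-monoʳ-≤ j (m≤m+n P (C + 2)))) ⟩
      D + suc j * (P + (C + 2))               ≤⟨ +-monoʳ-≤ D (*-monoʳ-≤ (suc j) (totalDeficit-bound nQ 3≤nQ C)) ⟩
      D + suc j * (3 * nQ ^ C)                ≡⟨ cong (D +_) (*-assoc (suc j) 3 (nQ ^ C)) ⟨
      D + suc j * 3 * nQ ^ C                  ≤⟨ +-monoʳ-≤ D (*-monoˡ-≤ (nQ ^ C) j≤k) ⟩
      D + k * nQ ^ C                          ∎
      where
      open ≤-Reasoning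
      regroup : ∀ C D P j → suc (suc (C + D) + suc j * P) ≡ D + (P + (C + 2) + j * P)
      regroup = solve-∀
      regroup′ : ∀ C D N R → suc (C * suc N + D) + R ≡ suc (C + D) + R + C * N
      regroup′ = solve-∀
      bound : x ≤ suc (C + D) + suc j * P
      bound = +-cancelʳ-≤ (C * N) _ _ (begin
        x + C * N                             ≤⟨ lo ⟩
        W + suc j * P                         ≤⟨ +-monoˡ-≤ (suc j * P) hi ⟩
        suc (C * suc N + D) + suc j * P       ≡⟨ regroup′ C D N (suc j * P) ⟩
        suc (C + D) + suc j * P + C * N       ∎)

    heavy-prefix : ∀ vs {ws} → Heavy (vs ++ ws) → Heavy vs
    heavy-prefix vs {ws} h as c bs zs refl = h as c bs (zs ++ ws)
      (trans (++-assoc as _ ws) (cong (as ++_) (++-assoc (c ∷ bs) (c ∷ zs) ws)))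

    record Pieces (X : Word) (as : List Word) (c : Word) (bs zs : List Word) (Z : Word) : Set where
      field
        {u₁ u₂ u₃} : List (Sym M)
        {a₂} : Sym M
        first  : Path X u₁ as c
        middle : Path c (a₂ ∷ u₂) (c ∷ bs) c
        last   : Path c u₃ (c ∷ zs) Z

    pieces : ∀ {X u Z} as c bs zs → Path X u (as ++ (c ∷ bs) ++ c ∷ zs) Z → Pieces X as c bs zs Z
    pieces as c bs zs p with path-split as ((c ∷ bs) ++ c ∷ zs) p
    ... | _ , _ , _ , p₁ , p′ with path-split (c ∷ bs) (c ∷ zs) p′
    ... | _ , _ , _ , p₂@(_ ∷ _) , p₃@(_ ∷ _) = record { first = p₁ ; middle = p₂ ; last = p₃ }

    gap-arithmetic : ∀ a b z w₁ w₂ w₃ t →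
      suc (C * suc (a + (b + z)) + D) + (w₁ + w₃) ≤ t + (w₁ + (w₂ + w₃)) →
      t ≤ C * suc (a + z) + D → C * b < w₂
    gap-arithmetic a b z w₁ w₂ w₃ t exchange bound = +-cancelʳ-≤ rest _ _ (begin
      suc (C * b) + rest                                  ≡⟨ regroup C D a b z (w₁ + w₃) ⟩
      suc (C * suc (a + (b + z)) + D) + (w₁ + w₃)         ≤⟨ exchange ⟩
      t + (w₁ + (w₂ + w₃))                                ≤⟨ +-monoˡ-≤ _ bound ⟩
      C * suc (a + z) + D + (w₁ + (w₂ + w₃))              ≡⟨ regroup′ (C * suc (a + z) + D) w₁ w₂ w₃ ⟩
      w₂ + rest                                           ∎)
      where
      open ≤-Reasoning
      rest : ℕ
      rest = C * suc (a + z) + D + (w₁ + w₃)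
      regroup : ∀ C D a b z w → suc (C * b) + (C * suc (a + z) + D + w) ≡
        suc (C * suc (a + (b + z)) + D) + w
      regroup = solve-∀
      regroup′ : ∀ r a b c → r + (a + (b + c)) ≡ b + (r + (a + c))
      regroup′ = solve-∀

    length-pieces : ∀ (as : List Word) {c : Word} bs zs →
      length (as ++ (c ∷ bs) ++ c ∷ zs) ≡ length as + (suc (length bs) + suc (length zs))
    length-pieces as bs zs = trans (length-++ as) (cong (λ k → length as + suc k) (length-++ bs))

    weight-pieces : ∀ as c bs zs →
      weight (as ++ (c ∷ bs) ++ c ∷ zs) ≡ weight as + (weight (c ∷ bs) + weight (c ∷ zs))
    weight-pieces as c bs zs =
      trans (weight-++ as _) (cong (weight as +_) (weight-++ (c ∷ bs) (c ∷ zs)))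

    module _ {a₀ u X Z vs} (E : Ends a₀ X Z) (p : Path X u vs Z)
      (ms : List (Move M)) (h : HasCrossings E vs ms)
      (overlong : length ms ≡ suc (C * suc (length u) + D))
      (shorter : ∀ {n} → n < suc (length u) → TimeBound C D n) where

      overlong′ : length ms ≡ suc (C * suc (length vs) + D)
      overlong′ = trans overlong (cong (λ n → suc (C * suc n + D)) (sym (path-length p)))

      -- Cutting out the stretch between two equal crossing sequences gives a
      -- shorter input, on which the remaining run obeys the time bound.
      heavy : Heavy vs
      heavy as c bs zs refl with pieces as c bs zs p
      ... | record { u₁ = u₁ ; u₃ = u₃ ; first = p₁ ; last = p₃ } =
        cut (path⇒run E (p₁ ++ₚ p₃) (shorter lt _))
        where
        u₁₃-length : length (u₁ ++ u₃) ≡ length as + suc (length zs)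
        u₁₃-length = trans (sym (path-length (p₁ ++ₚ p₃))) (length-++ as)
        lt : suc (length (u₁ ++ u₃)) < suc (length u)
        lt = s≤s (begin-strict
          length (u₁ ++ u₃)                ≡⟨ u₁₃-length ⟩
          length as + suc (length zs)      <⟨ +-monoʳ-< (length as) (s≤s (m≤n+m _ (length bs))) ⟩
          length as + (suc (length bs) + suc (length zs)) ≡⟨ length-pieces as bs zs ⟨
          length vs                        ≡⟨ path-length p ⟩
          length u                         ∎)
          where open ≤-Reasoning
        cut : Σ[ ms′ ∈ List (Move M) ] ValidFrom M (start a₀ (u₁ ++ u₃)) ms′ ×
          HasCrossings E (as ++ c ∷ zs) ms′ → C * suc (length bs) < weight (c ∷ bs)
        cut (ms′ , v′ , h′) = gap-arithmetic (length as) (suc (length bs)) (suc (length zs))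
          (weight as) (weight (c ∷ bs)) (weight (c ∷ zs)) (length ms′)
          (subst₂ _≤_
            (cong₂ _+_ (trans overlong′ (cong (λ n → suc (C * suc n + D)) (length-pieces as bs zs)))
              (weight-++ as (c ∷ zs)))
            (cong (length ms′ +_) (weight-pieces as c bs zs))
            (length-exchange E vs ms (as ++ c ∷ zs) ms′ h h′))
          (subst (λ n → length ms′ ≤ C * suc n + D) u₁₃-length (shorter lt _ ms′ v′))

      weight≤ : weight vs ≤ suc (C * suc (length vs) + D)
      weight≤ = subst (weight vs ≤_) overlong′ (weight≤length E vs ms h)

      module _ (small : ∀ {n} → n ≤ ℓ → TimeBound C D n) (slow : SlowParts ℓ r C) where

        -- An innermost repetition is short enough for (b), and its word still occurs on the short
        -- input made of the two reduced sides. So (b) applies to the stretch and contradicts its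
        -- heaviness.
        impossible : ℓ < suc (length u) → ⊥
        impossible ℓ< with unique-or-repetition _≟ʷ_ vs
        ... | inj₁ un = <⇒≱ ℓ< (subst (λ n → suc n ≤ ℓ) (path-length p)
          (count 0 8 (subst (λ k → suc C * length vs ≤ weight vs + k) (sym (+-identityʳ P))
            (unique⇒*-length≤ nQ (suc C) un)) weight≤ (m≤m+n 3 5)))
        ... | inj₂ (repetition {as} {c} {bs} {zs} refl un) = contradict c refl
          where
          open Pieces (pieces as c bs zs p)
          R₁ : Reduced X as c
          R₁ = reduce _ ≤-refl (heavy-prefix as heavy) first
          R₂ : Reduced c (c ∷ zs) Z
          R₂ = reduce _ ≤-refl
            (heavy-suffix (as ++ c ∷ bs) (subst Heavy (sym (++-assoc as (c ∷ bs) (c ∷ zs))) heavy)) last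
          open Reduced R₁ using () renaming (input to u₁′; words to as′; path to p₁)
          open Reduced R₂ using () renaming (input to u₃′; words to zs′; path to p₃)
          open ≤-Reasoning
          a k z w₁ w₂ w₃ : ℕ
          a = length as
          k = suc (length bs)
          z = suc (length zs)
          w₁ = weight as
          w₂ = weight (c ∷ bs)
          w₃ = weight (c ∷ zs)

          k≤r : k ≤ r
          -- Three duplicate-free lists: the repetition and the two reduced sides, whose lengths are
          -- dropped.
          k≤r = ≤-trans (n≤1+n k) (count 2 12 (begin
            k + C * length vs                       ≡⟨ cong (λ n → k + C * n) (length-pieces as bs zs) ⟩
            k + C * (a + (k + z))                   ≡⟨ regroup C a k z ⟩
            C * a + (suc C * k + C * z)
              ≤⟨ +-mono-≤ (≤-trans (m≤n+m _ (length as′)) (reduced-short R₁))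
                   (+-mono-≤ (unique⇒*-length≤ nQ (suc C) un)
                     (≤-trans (m≤n+m _ (length zs′)) (reduced-short R₂))) ⟩
            w₁ + P + (w₂ + P + (w₃ + P))            ≡⟨ regroup′ w₁ w₂ w₃ P ⟩
            w₁ + (w₂ + w₃) + 3 * P                  ≡⟨ cong (_+ 3 * P) (weight-pieces as c bs zs) ⟨
            weight vs + 3 * P                       ∎) weight≤ (m≤m+n 9 3))
            where
            regroup : ∀ C a k z → k + C * (a + (k + z)) ≡ C * a + (suc C * k + C * z)
            regroup = solve-∀
            regroup′ : ∀ a b c P → a + P + (b + P + (c + P)) ≡ a + (b + c) + 3 * P
            regroup′ = solve-∀

          u′-length : length (u₁′ ++ u₃′) ≡ length as′ + length zs′
          u′-length = trans (sym (path-length (p₁ ++ₚ p₃))) (length-++ as′)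

          n′≤ℓ : suc (length (u₁′ ++ u₃′)) ≤ ℓ
          -- Only the two reduced sides cost a P; the stretch between them enters through its
          -- heaviness.
          n′≤ℓ = subst (λ n → suc n ≤ ℓ) (sym u′-length) (count 1 8 (begin
            length as′ + length zs′ + C * length vs
              ≡⟨ cong (λ n → length as′ + length zs′ + C * n) (length-pieces as bs zs) ⟩
            length as′ + length zs′ + C * (a + (k + z))
              ≡⟨ regroup C (length as′) (length zs′) a k z ⟩
            length as′ + C * a + (C * k + (length zs′ + C * z))
              ≤⟨ +-mono-≤ (reduced-short R₁)
                   (+-mono-≤ (<⇒≤ (heavy as c bs zs refl)) (reduced-short R₂)) ⟩
            w₁ + P + (w₂ + (w₃ + P))                ≡⟨ regroup′ w₁ w₂ w₃ P ⟩
            w₁ + (w₂ + w₃) + 2 * P                  ≡⟨ cong (_+ 2 * P) (weight-pieces as c bs zs) ⟨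
            weight vs + 2 * P                       ∎) weight≤ (m≤m+n 6 2))
            where
            regroup : ∀ C x y a k z → x + y + C * (a + (k + z)) ≡ x + C * a + (C * k + (y + C * z))
            regroup = solve-∀
            regroup′ : ∀ a b c P → a + P + (b + (c + P)) ≡ a + (b + c) + 2 * P
            regroup′ = solve-∀

          c∈S : InSUpTo M ℓ c
          c∈S = _ , s≤s z≤n , n′≤ℓ , boundary∈S E p₁ p₃ (small n′≤ℓ _)

          contradict : ∀ c′ → c ≡ c′ → ⊥
          contradict [] e = n≮0 (subst (C * k <_) (path-[] e middle) (heavy as c bs zs refl))
          contradict (q ∷ X′) refl with path⇒partComputation a₂ u₂ middle
          ... | ζ , e = <⇒≱ (heavy as c bs zs refl) (subst₂ _≤_ e (cong (C *_) k≡)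
            (slow c c∈S (length u₂) (fromList (a₂ ∷ u₂)) (subst (_≤ r) (sym k≡) k≤r) ζ))
            where
            k≡ : suc (length u₂) ≡ k
            k≡ = sym (path-length middle)

    slowParts⇒bounded : (∀ {n} → n ≤ ℓ → TimeBound C D n) → SlowParts ℓ r C → ∀ n → TimeBound C D n
    slowParts⇒bounded small slow = <-rec (TimeBound C D) step
      where
      step : ∀ n → (∀ {m} → m < n → TimeBound C D m) → TimeBound C D n
      step n shorter w with n ≤? ℓ
      ... | yes n≤ℓ = small n≤ℓ w
      ... | no n≰ℓ with asList w
      ... | list [] = ⊥-elim (n≰ℓ z≤n)
      ... | list (a₀ ∷ u) = λ ms v → ≮⇒≥ λ long →
        let T = C * suc (length u) + D
            -- Truncation makes the excess exactly one step, which keeps the total weight at most T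
            -- + 1.
            ms′ = take (suc T) ms
            _ , _ , _ , E , p , h = run⇒path a₀ u ms′ (take-valid (suc T) ms v)
        in impossible E p ms′ h (trans (length-take (suc T) ms) (m≤n⇒m⊓n≡m long)) shorter
             small slow (≰⇒> n≰ℓ)

theorem1 : (M : NTM) (C D : ℕ) →
    let q = NTM.nQ M
        ℓ = D + 8 * q ^ C
        r = D + 12 * q ^ C
    in RunsInTime M (λ n → C * n + D) ⇔
       ((∀ n (w : Vec (Sym M) n) → n ≤ ℓ → (ζ : Computation M w) →
           LengthAtMost M ζ (C * n + D))
        ×
        (∀ (cs : List (State M)) → InSUpTo M ℓ cs →
           ∀ m (w : Vec (Sym M) (suc m)) → suc m ≤ r →
           (ζ : PartComputation M w cs) → partLength M w cs ζ ≤ C * suc m))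
theorem1 M C D = mk⇔
  (λ run → (λ n w _ → run n w) ,
    bounded⇒slowParts C D (λ n w → computations≤⇒runs≤ w _ (run n w)) _ _)
  (λ (small , slow) n w → runs≤⇒computations≤ w _
    (slowParts⇒bounded C D (λ n≤ℓ w′ → computations≤⇒runs≤ w′ _ (small _ w′ n≤ℓ)) slow n w))
  where
  open Computations M
  open Main M
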